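{- Let $p\ge 3$ be a prime. Then $\mathcal{I}(\mathbb{Z}_{p^2},2)=p^3$. Moreover, every integral point set in $\mathbb{Z}_{p^2}^2$ of cardinality $p^3$ is isomorphic to one of the following sets: (a) $\{(i,jp)\mid i,j\in\mathbb{Z}_{p^2}\}$; (b) (only if $-1$ is a square modulo $p$) $\{(i,i\omega+jp)\mid i,j\in\mathbb{Z}_{p^2}\}$, where $\omega\in\mathbb{Z}_{p^2}$ satisfies $\omega^2=-1$; (c) (only if $-1$ is a square modulo $p$) the set of all $(x,y)\in\mathbb{Z}_{p^2}^2$ whose reduction modulo $p$ lies in $\{(s,\omega_p s)\mid s\in\square_{\mathbb{Z}_p}\}\cup\{(s,-\omega_p s)\mid s\in\square_{\mathbb{Z}_p}\}$, where $\omega_p\in\mathbb{Z}_p$ satisfies $\omega_p^2=-1$.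
   Context: $\mathbb{Z}_n=\mathbb{Z}/n\mathbb{Z}$. For a commutative ring $\mathcal{R}$ with $1$ put $\square_{\mathcal{R}}=\{t^2\mid t\in\mathcal{R}\}$. For $u,v\in\mathcal{R}^2$ let $d^2(u,v)=(u_1-v_1)^2+(u_2-v_2)^2$; $u,v$ are at integral distance if $d^2(u,v)\in\square_{\mathcal{R}}$, and then $\Delta(u,v)=1$; otherwise $\Delta(u,v)=0$. An integral point set in $\mathcal{R}^2$ is a set of points pairwise at integral distance; $\mathcal{I}(\mathcal{R},2)$ is the maximum cardinality of such a set. An automorphism of $\mathcal{R}^2$ with respect to $\Delta$ is a bijection $\varphi$ of $\mathcal{R}^2$ with $\Delta(\varphi(u),\varphi(v))=\Delta(u,v)$ for all $u,v$ and such that for all $u,w\in\mathcal{R}^2$ there are $u',w'\in\mathcal{R}^2$ with $\{\varphi(u+tw)\mid t\in\mathcal{R}\}=\{u'+tw'\mid t\in\mathcal{R}\}$. Two point sets are isomorphic if some such automorphism maps one onto the other. -}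

module Defs where

open import Algebra.Bundles using (CommutativeRing)
open import Data.Bool using (if_then_else_)
open import Data.Fin using (Fin; toℕ)
open import Data.Fin.Properties using (toℕ-fromℕ<; toℕ-injective; toℕ<n; any?; _≟_)
open import Data.Nat
  using (ℕ; NonZero; _+_; _*_; _∸_; _^_; _%_; _≤_)
open import Data.Nat.DivMod
  using (_mod_; %-distribˡ-+; %-distribˡ-*; m%n%n≡m%n; m<n⇒m%n≡m; n%n≡0; m%n<n)
open import Data.Nat.Properties
  using (+-comm; +-assoc; +-identityˡ; *-comm; *-assoc; *-identityˡ; *-distribˡ-+;
         m+[n∸m]≡n; <⇒≤; m^n≢0)
open import Data.Product using (_×_; _,_; ∃; ∃₂)
open import Function.Bundles using (_⇔_)
open import Function.Definitions using (Injective; Bijective)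
open import Level using (0ℓ)
open import Relation.Binary.PropositionalEquality
  using (_≡_; refl; sym; trans; cong; cong₂; isEquivalence; module ≡-Reasoning)
open import Relation.Nullary using (Dec; does)
open import Relation.Unary using (Pred; _∈_; _≐_; _∪_)

module ModularArithmetic (n : ℕ) .{{_ : NonZero n}} where

  infixl 6 _⊕_
  infixl 7 _⊗_

  _⊕_ _⊗_ : Fin n → Fin n → Fin n
  x ⊕ y = (toℕ x + toℕ y) mod n
  x ⊗ y = (toℕ x * toℕ y) mod n

  ⊖_ : Fin n → Fin n
  ⊖ x = (n ∸ toℕ x) mod n

  toℕ-mod : ∀ a → toℕ (a mod n) ≡ a % n
  toℕ-mod a = toℕ-fromℕ< (m%n<n a n)

  mod-cong : ∀ {a b} → a % n ≡ b % n → a mod n ≡ b mod n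
  mod-cong {a} {b} eq = toℕ-injective (trans (toℕ-mod a) (trans eq (sym (toℕ-mod b))))

  mod-toℕ : ∀ x → toℕ x mod n ≡ x
  mod-toℕ x = toℕ-injective (trans (toℕ-mod (toℕ x)) (m<n⇒m%n≡m (toℕ<n x)))

  mod-⊕ : ∀ a b → (a mod n) ⊕ (b mod n) ≡ (a + b) mod n
  mod-⊕ a b = mod-cong (trans (cong₂ (λ s t → (s + t) % n) (toℕ-mod a) (toℕ-mod b))
                              (sym (%-distribˡ-+ a b n)))

  mod-⊗ : ∀ a b → (a mod n) ⊗ (b mod n) ≡ (a * b) mod n
  mod-⊗ a b = mod-cong (trans (cong₂ (λ s t → (s * t) % n) (toℕ-mod a) (toℕ-mod b))
                              (sym (%-distribˡ-* a b n)))

  ⊕-comm : ∀ x y → x ⊕ y ≡ y ⊕ x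
  ⊕-comm x y = cong (_mod n) (+-comm (toℕ x) (toℕ y))

  ⊗-comm : ∀ x y → x ⊗ y ≡ y ⊗ x
  ⊗-comm x y = cong (_mod n) (*-comm (toℕ x) (toℕ y))

  ⊕-assoc : ∀ x y z → (x ⊕ y) ⊕ z ≡ x ⊕ (y ⊕ z)
  ⊕-assoc x y z = begin
    (x ⊕ y) ⊕ z                       ≡⟨ cong ((x ⊕ y) ⊕_) (mod-toℕ z) ⟨
    (x ⊕ y) ⊕ (toℕ z mod n)           ≡⟨ mod-⊕ (toℕ x + toℕ y) (toℕ z) ⟩
    (toℕ x + toℕ y + toℕ z) mod n     ≡⟨ cong (_mod n) (+-assoc (toℕ x) (toℕ y) (toℕ z)) ⟩
    (toℕ x + (toℕ y + toℕ z)) mod n   ≡⟨ mod-⊕ (toℕ x) (toℕ y + toℕ z) ⟨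
    (toℕ x mod n) ⊕ (y ⊕ z)           ≡⟨ cong (_⊕ (y ⊕ z)) (mod-toℕ x) ⟩
    x ⊕ (y ⊕ z)                       ∎
    where open ≡-Reasoning

  ⊗-assoc : ∀ x y z → (x ⊗ y) ⊗ z ≡ x ⊗ (y ⊗ z)
  ⊗-assoc x y z = begin
    (x ⊗ y) ⊗ z                       ≡⟨ cong ((x ⊗ y) ⊗_) (mod-toℕ z) ⟨
    (x ⊗ y) ⊗ (toℕ z mod n)           ≡⟨ mod-⊗ (toℕ x * toℕ y) (toℕ z) ⟩
    (toℕ x * toℕ y * toℕ z) mod n     ≡⟨ cong (_mod n) (*-assoc (toℕ x) (toℕ y) (toℕ z)) ⟩
    (toℕ x * (toℕ y * toℕ z)) mod n   ≡⟨ mod-⊗ (toℕ x) (toℕ y * toℕ z) ⟨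
    (toℕ x mod n) ⊗ (y ⊗ z)           ≡⟨ cong (_⊗ (y ⊗ z)) (mod-toℕ x) ⟩
    x ⊗ (y ⊗ z)                       ∎
    where open ≡-Reasoning

  ⊕-identityˡ : ∀ x → (0 mod n) ⊕ x ≡ x
  ⊕-identityˡ x = begin
    (0 mod n) ⊕ x               ≡⟨ cong ((0 mod n) ⊕_) (mod-toℕ x) ⟨
    (0 mod n) ⊕ (toℕ x mod n)   ≡⟨ mod-⊕ 0 (toℕ x) ⟩
    toℕ x mod n                 ≡⟨ mod-toℕ x ⟩
    x                           ∎
    where open ≡-Reasoning

  ⊗-identityˡ : ∀ x → (1 mod n) ⊗ x ≡ x
  ⊗-identityˡ x = begin
    (1 mod n) ⊗ x               ≡⟨ cong ((1 mod n) ⊗_) (mod-toℕ x) ⟨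
    (1 mod n) ⊗ (toℕ x mod n)   ≡⟨ mod-⊗ 1 (toℕ x) ⟩
    (1 * toℕ x) mod n           ≡⟨ cong (_mod n) (*-identityˡ (toℕ x)) ⟩
    toℕ x mod n                 ≡⟨ mod-toℕ x ⟩
    x                           ∎
    where open ≡-Reasoning

  ⊕-inverseʳ : ∀ x → x ⊕ (⊖ x) ≡ 0 mod n
  ⊕-inverseʳ x = begin
    x ⊕ (⊖ x)                   ≡⟨ cong (_⊕ (⊖ x)) (mod-toℕ x) ⟨
    (toℕ x mod n) ⊕ (⊖ x)       ≡⟨ mod-⊕ (toℕ x) (n ∸ toℕ x) ⟩
    (toℕ x + (n ∸ toℕ x)) mod n ≡⟨ cong (_mod n) (m+[n∸m]≡n (<⇒≤ (toℕ<n x))) ⟩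
    n mod n                     ≡⟨ mod-cong (trans (n%n≡0 n) (sym (0%n n))) ⟩
    0 mod n                     ∎
    where
    open ≡-Reasoning
    0%n : ∀ m .{{_ : NonZero m}} → 0 % m ≡ 0
    0%n (ℕ.suc _) = refl

  ⊗-distribˡ-⊕ : ∀ x y z → x ⊗ (y ⊕ z) ≡ (x ⊗ y) ⊕ (x ⊗ z)
  ⊗-distribˡ-⊕ x y z = begin
    x ⊗ (y ⊕ z)                               ≡⟨ cong (_⊗ (y ⊕ z)) (mod-toℕ x) ⟨
    (toℕ x mod n) ⊗ (y ⊕ z)                   ≡⟨ mod-⊗ (toℕ x) (toℕ y + toℕ z) ⟩
    (toℕ x * (toℕ y + toℕ z)) mod n           ≡⟨ cong (_mod n) (*-distribˡ-+ (toℕ x) (toℕ y) (toℕ z)) ⟩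
    (toℕ x * toℕ y + toℕ x * toℕ z) mod n     ≡⟨ mod-⊕ (toℕ x * toℕ y) (toℕ x * toℕ z) ⟨
    (x ⊗ y) ⊕ (x ⊗ z)                         ∎
    where open ≡-Reasoning

ℤ/ : (n : ℕ) .{{_ : NonZero n}} → CommutativeRing 0ℓ 0ℓ
ℤ/ n = record
  { Carrier = Fin n
  ; _≈_ = _≡_
  ; _+_ = _⊕_
  ; _*_ = _⊗_
  ; -_  = ⊖_
  ; 0#  = 0 mod n
  ; 1#  = 1 mod n
  ; isCommutativeRing = record
    { isRing = record
      { +-isAbelianGroup = record
        { isGroup = record
          { isMonoid = record
            { isSemigroup = record
              { isMagma = record { isEquivalence = isEquivalence ; ∙-cong = cong₂ _⊕_ }
              ; assoc = ⊕-assoc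
              }
            ; identity = ⊕-identityˡ , λ x → trans (⊕-comm x _) (⊕-identityˡ x)
            }
          ; inverse = (λ x → trans (⊕-comm _ x) (⊕-inverseʳ x)) , ⊕-inverseʳ
          ; ⁻¹-cong = cong ⊖_
          }
        ; comm = ⊕-comm
        }
      ; *-cong = cong₂ _⊗_
      ; *-assoc = ⊗-assoc
      ; *-identity = ⊗-identityˡ , λ x → trans (⊗-comm x _) (⊗-identityˡ x)
      ; distrib = ⊗-distribˡ-⊕
                , λ x y z → trans (⊗-comm (y ⊕ z) x)
                              (trans (⊗-distribˡ-⊕ x y z) (cong₂ _⊕_ (⊗-comm x y) (⊗-comm x z)))
      }
    ; *-comm = ⊗-comm
    }
  }
  where open ModularArithmetic n

module Plane (n : ℕ) .{{_ : NonZero n}} where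

  private module R = CommutativeRing (ℤ/ n)

  Point : Set
  Point = R.Carrier × R.Carrier

  PointSet : Set₁
  PointSet = Pred Point 0ℓ

  □ : Pred R.Carrier 0ℓ
  □ x = ∃ λ t → x ≡ t R.* t

  □? : ∀ x → Dec (x ∈ □)
  □? x = any? λ t → x ≟ t R.* t

  d² : Point → Point → R.Carrier
  d² (u₁ , u₂) (v₁ , v₂) =
    (u₁ R.- v₁) R.* (u₁ R.- v₁) R.+ (u₂ R.- v₂) R.* (u₂ R.- v₂)

  Δ : Point → Point → ℕ
  Δ u v = if does (□? (d² u v)) then 1 else 0

  IsIntegral : Pred PointSet 0ℓ
  IsIntegral S = ∀ u v → u ∈ S → v ∈ S → d² u v ∈ □

  -- Counting via an enumeration rather than a bijection with ∃ S, since
  -- membership proofs need not be unique.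
  HasCardinality : PointSet → ℕ → Set
  HasCardinality S m = ∃ λ (e : Fin m → Point) →
    Injective _≡_ _≡_ e × (∀ x → x ∈ S ⇔ ∃ λ i → e i ≡ x)

  -- ℐ(ℤ/n, 2) = m
  IsMaxIntegralCardinality : ℕ → Set₁
  IsMaxIntegralCardinality m =
    (∃ λ S → IsIntegral S × HasCardinality S m) ×
    (∀ S k → IsIntegral S → HasCardinality S k → k ≤ m)

  image : (Point → Point) → PointSet → PointSet
  image φ S y = ∃ λ x → x ∈ S × φ x ≡ y

  -- The direction w is arbitrary: it may be zero or a zero divisor.
  line : Point → Point → PointSet
  line (u₁ , u₂) (w₁ , w₂) x = ∃ λ t → x ≡ (u₁ R.+ t R.* w₁ , u₂ R.+ t R.* w₂)

  record IsAutomorphism (φ : Point → Point) : Set where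
    field
      bijective   : Bijective _≡_ _≡_ φ
      preserves-Δ : ∀ u v → Δ (φ u) (φ v) ≡ Δ u v
      maps-lines  : ∀ u w → ∃₂ λ u′ w′ → image φ (line u w) ≐ line u′ w′

  Isomorphic : PointSet → PointSet → Set
  Isomorphic S T = ∃ λ φ → IsAutomorphism φ × image φ S ≐ T

instance
  p²-nonZero : ∀ {p} .{{_ : NonZero p}} → NonZero (p ^ 2)
  p²-nonZero {p} = m^n≢0 p 2

module PrimeSquare (p : ℕ) .{{_ : NonZero p}} where

  module F  = CommutativeRing (ℤ/ p)
  module R  = CommutativeRing (ℤ/ (p ^ 2))
  module F² = Plane p
  module R² = Plane (p ^ 2)

  reduce : R.Carrier → F.Carrier
  reduce x = toℕ x mod p

  pᴿ : R.Carrier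
  pᴿ = p mod (p ^ 2)

  setA : R².PointSet
  setA x = ∃₂ λ i j → x ≡ (i , j R.* pᴿ)

  setB : R.Carrier → R².PointSet
  setB ω x = ∃₂ λ i j → x ≡ (i , i R.* ω R.+ j R.* pᴿ)

  squareRay : F.Carrier → F².PointSet
  squareRay m x = ∃ λ s → s ∈ F².□ × x ≡ (s , m F.* s)

  setC : F.Carrier → R².PointSet
  setC ωₚ (x , y) = (reduce x , reduce y) ∈ squareRay ωₚ ∪ squareRay (F.- ωₚ)

{-# OPTIONS --safe #-}

-- A square of ℤ/p² that vanishes modulo p is 0.  Choose r with ν = r² + 1 not a
-- square modulo p: two points of an integral set S whose reductions differ by a
-- multiple of (r , 1) have equal reductions, so S has at most p reductions and,
-- each having p² lifts, at most p³ points.  If |S| = p³ then S contains all lifts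
-- of p points forming a graph over the direction (r , 1).  No two of these points
-- are at distance 0, as some of their lifts would not be at integral distance.  So
-- S determines only directions whose norm is a nonzero square, at most
-- (p + 1) / 2 of them, and by the argument of Rédei and of Lovász and Schrijver the
-- p points lie on a line; a similarity of square norm then takes S to the set of
-- case (a).  Cases (b) and (c) do not occur: those sets are not integral in the
-- plane over ℤ/p².

module Submission where

open import Defs
open import Algebra.Bundles using (CommutativeRing; RawRing)
open import Algebra.Core using (Op₁; Op₂)
open import Algebra.Structures using (IsCommutativeRing)
import Algebra.Properties.AbelianGroup
import Algebra.Properties.CommutativeSemigroup
import Algebra.Properties.Ring
import Algebra.Properties.Semiring.Exp
import Algebra.Properties.Semiring.Mult
import Algebra.Properties.Semiring.Mult.TCOptimised
import Algebra.Properties.Semiring.Sum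
import Algebra.Solver.Ring
import Algebra.Solver.Ring.AlmostCommutativeRing as ACR
open import Data.Bool using (if_then_else_)
open import Data.Empty using (⊥-elim)
open import Data.Fin using (Fin; toℕ; zero; suc; fromℕ<; punchOut; combine; remQuot)
open import Data.Fin.Permutation using (Permutation′; permutation)
open import Data.Fin.Properties
  using (_≟_; any?; ¬∀⟶∃¬; toℕ-injective; toℕ<n; toℕ-fromℕ<; suc-injective; injective⇒≤;
         punchOut-injective; combine-injective; combine-remQuot; remQuot-combine)
open import Data.List using (List; []; _∷_; length; map; allFin)
import Data.List.Membership.Propositional as List
open import Data.List.Membership.Propositional.Properties using (∈-map⁻)
open import Data.List.Properties using (length-map; length-tabulate)
open import Data.List.Relation.Unary.All as All using ([]; _∷_)
open import Data.List.Relation.Unary.All.Properties using (All¬⇒¬Any)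
open import Data.List.Relation.Unary.AllPairs using ([]; _∷_)
open import Data.List.Relation.Unary.Any using (here; there)
open import Data.List.Relation.Unary.Unique.Propositional using (Unique)
open import Data.List.Relation.Unary.Unique.Propositional.Properties using (allFin⁺; map⁺)
open import Data.Maybe using (just; nothing)
import Data.Nat as ℕ
open import Data.Nat using (ℕ; zero; suc; NonZero; _≤_; _<_; z≤n; s≤s)
open import Data.Nat.DivMod using (_mod_; _/_; _%_; m≡m%n+[m/n]*n; m%n<n; m<n*o⇒m/o<n; m∣n⇒o%n%m≡o%m)
open import Data.Nat.Divisibility using (_∣_; divides; n∣m⇒m%n≡0; m%n≡0⇒n∣m; >⇒∤; *-cancelʳ-∣)
open import Data.Nat.Primality using (Prime; euclidsLemma; prime⇒irreducible)
import Data.Nat.Properties as ℕ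
open import Data.Nat.Solver using (module +-*-Solver)
open import Data.Product using (_×_; _,_; ∃; ∃₂; proj₁; proj₂)
open import Data.Product.Properties using (,-injective)
open import Data.Sum as Sum using (_⊎_; inj₁; inj₂)
open import Function using (_∘_; id)
open import Function.Bundles using (_⇔_; mk⇔; Equivalence)
open import Function.Definitions using (Injective)
open import Level using (0ℓ)
open import Relation.Binary.Definitions using (DecidableEquality; WeaklyDecidable)
open import Relation.Binary.PropositionalEquality as ≡
  using (_≡_; _≢_; _≗_; refl; sym; trans; cong; cong₂; subst; module ≡-Reasoning)
import Relation.Binary.Reasoning.Setoid
open import Relation.Nullary using (Dec; yes; no; contradiction)
open import Relation.Nullary.Decidable using (does-⇔)
open import Relation.Unary using (_∈_; _∉_)


-- The coordinates x - r y and y + r x multiply the norm by ν, and in them the p points are the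
-- graph of a function `g` on ℤ/p. A slope -c with c² + 1 a square has square norm there, so its
-- norm in the old coordinates is 0 or a nonsquare and the points do not determine it: x ↦ g x + x c
-- is a permutation. For k ≤ h = (p - 1) / 2 the sum of (g x + x c)ᵏ over the field is therefore 0
-- at every such c. It is a polynomial in c of degree below k, and there are at least h such c, so
-- all its coefficients vanish; these moments of `g` leave no room for a degree above 1. Degrees are
-- read off iterated differences, because the (p - 1)-st difference of a function is its sum over
-- the field. The sets of (b) and (c) are not integral: each contains (0 , 0) and every lift of a
-- point (1 , ω) with ω² = -1 modulo p. The distances 1 + y² over the lifts y of ω run through all
-- multiples of p, and of these only 0 is a square.

-- The pair (a , b) stands for the integer a − b.
module IntegerSolver {c ℓ} (K : CommutativeRing c ℓ) where
  open CommutativeRing K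
    using (Carrier; _≈_; _+_; _*_; -_; _-_; 0#; 1#; setoid; semiring; ring; +-abelianGroup; +-commutativeSemigroup;
           +-cong; +-congˡ; +-congʳ; +-comm; +-identityˡ; +-identityʳ; -‿cong; -‿inverseʳ; *-cong; distribˡ; distribʳ)
    renaming (refl to ≈-refl; sym to ≈-sym; trans to ≈-trans)
  open Algebra.Properties.Semiring.Mult semiring using (×-homo-+; ×1-homo-*; ×-congˡ) renaming (_×_ to _·_)
  open Algebra.Properties.Semiring.Mult.TCOptimised semiring using (×ᵤ≈×) renaming (_×_ to _·′_)
  open Algebra.Properties.Ring ring using (-‿distribˡ-*; -‿distribʳ-*; -0#≈0#)
  open Algebra.Properties.AbelianGroup +-abelianGroup using (⁻¹-∙-comm; ⁻¹-involutive)
  open Algebra.Properties.CommutativeSemigroup +-commutativeSemigroup using (interchange)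
  open Relation.Binary.Reasoning.Setoid setoid

  private
    coefficients : RawRing 0ℓ 0ℓ
    coefficients = record
      { Carrier = ℕ × ℕ
      ; _≈_ = ≡._≡_
      ; _+_ = λ { (a , b) (c , d) → a ℕ.+ c , b ℕ.+ d }
      ; _*_ = λ { (a , b) (c , d) → a ℕ.* c ℕ.+ b ℕ.* d , a ℕ.* d ℕ.+ b ℕ.* c }
      ; -_ = λ { (a , b) → b , a }
      ; 0# = 0 , 0
      ; 1# = 1 , 0
      }

    difference : ℕ × ℕ → Carrier
    difference (a , b) = a · 1# - b · 1#

    subtract-sums : ∀ w x y z → (w - x) + (y - z) ≈ (w + y) - (x + z)
    subtract-sums w x y z = begin
      (w - x) + (y - z)     ≈⟨ interchange w (- x) y (- z) ⟩
      (w + y) + (- x - z)   ≈⟨ +-congˡ (⁻¹-∙-comm x z) ⟩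
      (w + y) - (x + z)     ∎

    -- Agrees with difference, but equal integers have the same value by
    -- computation, and 0, 1 and 2 evaluate to 0#, 1# and 1# + 1#.
    ⟦_⟧ : ℕ × ℕ → Carrier
    ⟦ a , ℕ.zero ⟧          = a ·′ 1#
    ⟦ ℕ.zero , b@(ℕ.suc _) ⟧ = - (b ·′ 1#)
    ⟦ ℕ.suc a , ℕ.suc b ⟧   = ⟦ a , b ⟧

    ⟦_⟧≈ : ∀ x → ⟦ x ⟧ ≈ difference x
    ⟦ a , ℕ.zero ⟧≈          = ≈-trans (≈-sym (≈-trans (+-congˡ -0#≈0#) (+-identityʳ _))) (+-congʳ (≈-sym (×ᵤ≈× a 1#)))
    ⟦ ℕ.zero , b@(ℕ.suc _) ⟧≈ = ≈-trans (≈-sym (+-identityˡ _)) (+-congˡ (-‿cong (≈-sym (×ᵤ≈× b 1#))))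
    ⟦ ℕ.suc a , ℕ.suc b ⟧≈   = begin
      ⟦ a , b ⟧                                  ≈⟨ ⟦ a , b ⟧≈ ⟩
      difference (a , b)                         ≈⟨ +-identityˡ _ ⟨
      0# + difference (a , b)                    ≈⟨ +-congʳ (-‿inverseʳ 1#) ⟨
      (1# - 1#) + (a · 1# - b · 1#)              ≈⟨ subtract-sums _ _ _ _ ⟩
      difference (ℕ.suc a , ℕ.suc b)             ∎

    +-homo : ∀ x y → difference (RawRing._+_ coefficients x y) ≈ difference x + difference y
    +-homo (a , b) (c , d) = begin
      (a ℕ.+ c) · 1# - (b ℕ.+ d) · 1#           ≈⟨ +-cong (×-homo-+ 1# a c) (-‿cong (×-homo-+ 1# b d)) ⟩
      (a · 1# + c · 1#) - (b · 1# + d · 1#)     ≈⟨ subtract-sums _ _ _ _ ⟨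
      difference (a , b) + difference (c , d)                     ∎

    multiply-differences : ∀ w x y z → (w - x) * (y - z) ≈ (w * y + x * z) - (w * z + x * y)
    multiply-differences w x y z = begin
      (w - x) * (y - z)                              ≈⟨ distribʳ _ _ _ ⟩
      w * (y - z) + - x * (y - z)                    ≈⟨ +-cong (distribˡ _ _ _) (distribˡ _ _ _) ⟩
      (w * y + w * - z) + (- x * y + - x * - z)      ≈⟨ +-cong (+-congˡ (-‿distribʳ-* w z)) (+-comm _ _) ⟨
      (w * y - w * z) + (- x * - z + - x * y)        ≈⟨ +-congˡ (+-cong -x*-z (≈-sym (-‿distribˡ-* x y))) ⟩
      (w * y - w * z) + (x * z - x * y)              ≈⟨ subtract-sums _ _ _ _ ⟩
      (w * y + x * z) - (w * z + x * y)              ∎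
      where
      -x*-z : - x * - z ≈ x * z
      -x*-z = begin
        - x * - z      ≈⟨ -‿distribˡ-* x (- z) ⟨
        - (x * - z)    ≈⟨ -‿cong (-‿distribʳ-* x z) ⟨
        - - (x * z)    ≈⟨ ⁻¹-involutive _ ⟩
        x * z          ∎

    *-homo : ∀ x y → difference (RawRing._*_ coefficients x y) ≈ difference x * difference y
    *-homo (a , b) (c , d) = begin
      (a ℕ.* c ℕ.+ b ℕ.* d) · 1# - (a ℕ.* d ℕ.+ b ℕ.* c) · 1#
        ≈⟨ +-cong (split a c b d) (-‿cong (split a d b c)) ⟩
      (a · 1# * c · 1# + b · 1# * d · 1#) - (a · 1# * d · 1# + b · 1# * c · 1#)
        ≈⟨ multiply-differences _ _ _ _ ⟨
      difference (a , b) * difference (c , d) ∎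
      where
      infixl 8 _·1
      _·1 : ℕ → Carrier
      n ·1 = n · 1#
      split : ∀ i j k l → (i ℕ.* j ℕ.+ k ℕ.* l) · 1# ≈ i · 1# * j · 1# + k · 1# * l · 1#
      split i j k l = ≈-trans (×-homo-+ 1# (i ℕ.* j) (k ℕ.* l)) (+-cong (×1-homo-* i j) (×1-homo-* k l))

    -‿homo : ∀ x → difference (RawRing.-_ coefficients x) ≈ - difference x
    -‿homo (a , b) = begin
      b · 1# - a · 1#          ≈⟨ +-comm _ _ ⟩
      - (a · 1#) + b · 1#      ≈⟨ +-congˡ (⁻¹-involutive _) ⟨
      - (a · 1#) - - (b · 1#)  ≈⟨ ⁻¹-∙-comm _ _ ⟩
      - (a · 1# - b · 1#)      ∎

    almostCommutativeRing : ACR.AlmostCommutativeRing c ℓ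
    almostCommutativeRing = ACR.fromCommutativeRing K

    morphism : coefficients ACR.-Raw-AlmostCommutative⟶ almostCommutativeRing
    morphism = record
      { ⟦_⟧ = ⟦_⟧
      ; +-homo = λ x y → ≈-trans ⟦ RawRing._+_ coefficients x y ⟧≈ (≈-trans (+-homo x y) (≈-sym (+-cong ⟦ x ⟧≈ ⟦ y ⟧≈)))
      ; *-homo = λ x y → ≈-trans ⟦ RawRing._*_ coefficients x y ⟧≈ (≈-trans (*-homo x y) (≈-sym (*-cong ⟦ x ⟧≈ ⟦ y ⟧≈)))
      ; -‿homo = λ x → ≈-trans ⟦ RawRing.-_ coefficients x ⟧≈ (≈-trans (-‿homo x) (≈-sym (-‿cong ⟦ x ⟧≈)))
      ; 0-homo = ≈-refl
      ; 1-homo = ≈-refl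
      }

    _coeff≟_ : WeaklyDecidable (ACR.Induced-equivalence morphism)
    (a , b) coeff≟ (c , d) with a ℕ.+ d ℕ.≟ c ℕ.+ b
    ... | no _ = nothing
    ... | yes a+d≡c+b = just (≈-trans ⟦ a , b ⟧≈ (≈-trans (begin
      a · 1# - b · 1#                          ≈⟨ +-identityʳ _ ⟨
      (a · 1# - b · 1#) + 0#                   ≈⟨ +-congˡ (-‿inverseʳ (d · 1#)) ⟨
      (a · 1# - b · 1#) + (d · 1# - d · 1#)    ≈⟨ subtract-sums _ _ _ _ ⟩
      (a · 1# + d · 1#) - (b · 1# + d · 1#)    ≈⟨ +-cong numerators (-‿cong (+-comm _ _)) ⟩
      (c · 1# + b · 1#) - (d · 1# + b · 1#)    ≈⟨ subtract-sums _ _ _ _ ⟨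
      (c · 1# - d · 1#) + (b · 1# - b · 1#)    ≈⟨ +-congˡ (-‿inverseʳ (b · 1#)) ⟩
      (c · 1# - d · 1#) + 0#                   ≈⟨ +-identityʳ _ ⟩
      c · 1# - d · 1#                          ∎) (≈-sym ⟦ c , d ⟧≈)))
      where
      numerators : a · 1# + d · 1# ≈ c · 1# + b · 1#
      numerators = begin
        a · 1# + d · 1#   ≈⟨ ×-homo-+ 1# a d ⟨
        (a ℕ.+ d) · 1#    ≈⟨ ×-congˡ a+d≡c+b ⟩
        (c ℕ.+ b) · 1#    ≈⟨ ×-homo-+ 1# c b ⟩
        c · 1# + b · 1#   ∎

  open Algebra.Solver.Ring coefficients almostCommutativeRing morphism _coeff≟_ public
    using (solve; _:=_; _:+_; _:*_; _:-_; :-_; con; Polynomial)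

  :1 :2 : ∀ {n} → Polynomial n
  :1 = con (1 , 0)
  :2 = con (2 , 0)

-- A missed value could be punched out of the codomain, leaving an injection of `Fin (suc n)` into
-- `Fin n`.
injective⇒surjective : ∀ {n} {f : Fin n → Fin n} → Injective _≡_ _≡_ f → ∀ y → ∃ λ x → f x ≡ y
injective⇒surjective {suc n} {f} f-inj y with any? (λ x → f x ≟ y)
... | yes found = found
... | no missed = ⊥-elim (ℕ.1+n≰n (injective⇒≤ {f = λ x → punchOut (y≢f x)} λ {a} {b} eq →
    f-inj (punchOut-injective (y≢f a) (y≢f b) eq)))
  where
  y≢f : ∀ x → y ≢ f x
  y≢f x y≡fx = missed (x , sym y≡fx)

-- Serves `eval-roots`, where one further parameter is discarded with each root. The entries being
-- distinct, at most one is lost.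
remove-one : ∀ {a} {A : Set a} → DecidableEquality A → (x : A) {ys : List A} → Unique ys →
  ∃ λ zs → Unique zs × (∀ {z} → z List.∈ zs → z List.∈ ys × z ≢ x) × length ys ≤ suc (length zs)
remove-one _≟ᴬ_ x {[]} [] = [] , [] , (λ ()) , z≤n
remove-one _≟ᴬ_ x {y ∷ ys} (y∉ys ∷ ys!) with y ≟ᴬ x
... | yes refl = ys , ys! , (λ z∈ys → there z∈ys , λ { refl → All¬⇒¬Any y∉ys z∈ys }) , ℕ.≤-refl
... | no y≢x with remove-one _≟ᴬ_ x ys!
...   | zs , zs! , zs⊆ , len = y ∷ zs , All.tabulate (λ z∈zs → All.lookup y∉ys (proj₁ (zs⊆ z∈zs))) ∷ zs!
        , (λ { (here refl) → here refl , y≢x ; (there z∈zs) → there (proj₁ (zs⊆ z∈zs)) , proj₂ (zs⊆ z∈zs) })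
        , s≤s len

-- Difference calculus over a commutative ring.

module FiniteDifferences {A : Set} {_⊕_ _⊗_ : Op₂ A} {⊖_ : Op₁ A} {𝟘 𝟙 : A}
  (isCommutativeRing : IsCommutativeRing _≡_ _⊕_ _⊗_ ⊖_ 𝟘 𝟙) where

  ring : CommutativeRing _ _
  ring = record { isCommutativeRing = isCommutativeRing }

  open CommutativeRing ring public
    using (_+_; _*_; -_; _-_; 0#; 1#; +-comm; +-assoc; +-identityˡ; +-identityʳ; -‿inverseʳ; *-comm; *-assoc;
           *-identityˡ; *-identityʳ; zeroˡ; zeroʳ; distribˡ; distribʳ)
  private module K = CommutativeRing ring
  open IntegerSolver ring public
  open Algebra.Properties.Semiring.Exp K.semiring public using (_^_)
  open Algebra.Properties.Semiring.Mult K.semiring public using (×-homo-+) renaming (_×_ to _·_)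
  open ≡-Reasoning

  ι : ℕ → A
  ι n = n · 1#

  1^ : ∀ n → 1# ^ n ≡ 1#
  1^ zero    = refl
  1^ (suc n) = trans (*-identityˡ _) (1^ n)

  fact : ℕ → A
  fact zero    = 1#
  fact (suc n) = ι (suc n) * fact n

  D : (A → A) → A → A
  D g x = g (1# + x) - g x

  Dⁿ : ℕ → (A → A) → A → A
  Dⁿ zero    g = g
  Dⁿ (suc n) g = Dⁿ n (D g)

  Dⁿ-suc : ∀ n g x → Dⁿ (suc n) g x ≡ Dⁿ n g (1# + x) - Dⁿ n g x
  Dⁿ-suc zero    g x = refl
  Dⁿ-suc (suc n) g x = Dⁿ-suc n (D g) x

  -- In characteristic zero: g is a polynomial function of degree at most n
  -- with coefficient c at degree n.
  Lead : ℕ → A → (A → A) → Set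
  Lead zero    c g = ∀ x → g x ≡ c
  Lead (suc n) c g = Lead n (ι (suc n) * c) (D g)

  Lead-cong : ∀ n {c c′ g g′} → c ≡ c′ → g ≗ g′ → Lead n c g → Lead n c′ g′
  Lead-cong zero    c≡ g≗ l x = trans (sym (g≗ x)) (trans (l x) c≡)
  Lead-cong (suc n) c≡ g≗ l =
    Lead-cong n (cong (ι (suc n) *_) c≡) (λ x → cong₂ _-_ (g≗ (1# + x)) (g≗ x)) l

  Lead-+ : ∀ n {c c′ g g′} → Lead n c g → Lead n c′ g′ → Lead n (c + c′) (λ x → g x + g′ x)
  Lead-+ zero    l l′ x = cong₂ _+_ (l x) (l′ x)
  Lead-+ (suc n) {c} {c′} {g} {g′} l l′ =
    Lead-cong n (sym (distribˡ _ c c′))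
      (λ x → solve 4 (λ a b c d → (a :- b) :+ (c :- d) := (a :+ c) :- (b :+ d)) refl
        (g (1# + x)) (g x) (g′ (1# + x)) (g′ x))
      (Lead-+ n l l′)

  Lead-scale : ∀ n a {c g} → Lead n c g → Lead n (a * c) (λ x → a * g x)
  Lead-scale zero    a l x = cong (a *_) (l x)
  Lead-scale (suc n) a {c} {g} l =
    Lead-cong n (solve 3 (λ a i c → a :* (i :* c) := i :* (a :* c)) refl a (ι (suc n)) c)
      (λ x → solve 3 (λ a u v → a :* (u :- v) := a :* u :- a :* v) refl a (g (1# + x)) (g x))
      (Lead-scale n a l)

  Lead-shift : ∀ n {c g} → Lead n c g → Lead n c (λ x → g (1# + x))
  Lead-shift zero    l x = l (1# + x)
  Lead-shift (suc n) l = Lead-shift n l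

  -- Leibniz rule: D (g g′) is D g times the shifted g′, plus g times D g′. Both terms lose one
  -- degree, and their coefficients (d + 1) c c′ and (e + 1) c c′ add up to the required (d + e + 2)
  -- c c′.
  Lead-* : ∀ d e {c c′ g g′} → Lead d c g → Lead e c′ g′ → Lead (d ℕ.+ e) (c * c′) (λ x → g x * g′ x)
  Lead-* zero e l l′ = Lead-cong e refl (λ x → cong (_* _) (sym (l x))) (Lead-scale e _ l′)
  Lead-* (suc d) zero {c} {c′} {g} {g′} l l′ =
    subst (λ n → Lead n (c * c′) (λ x → g x * g′ x)) (sym (ℕ.+-identityʳ (suc d)))
      (Lead-cong (suc d) (*-comm c′ c) (λ x → trans (*-comm c′ (g x)) (cong (g x *_) (sym (l′ x))))
        (Lead-scale (suc d) c′ l))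
  Lead-* (suc d) (suc e) {c} {c′} {g} {g′} l l′ =
    Lead-cong (d ℕ.+ suc e) coefficient leibniz
      (Lead-+ (d ℕ.+ suc e)
        (Lead-* d (suc e) l (Lead-shift (suc e) l′))
        (subst (λ n → Lead n (c * (ι (suc e) * c′)) (λ x → g x * D g′ x)) (sym (ℕ.+-suc d e)) (Lead-* (suc d) e l l′)))
    where
    leibniz : ∀ x → D g x * g′ (1# + x) + g x * D g′ x ≡ D (λ y → g y * g′ y) x
    leibniz x = solve 4 (λ a b a′ b′ → (a :- b) :* a′ :+ b :* (a′ :- b′) := a :* a′ :- b :* b′) refl
      (g (1# + x)) (g x) (g′ (1# + x)) (g′ x)
    coefficient : (ι (suc d) * c) * c′ + c * (ι (suc e) * c′) ≡ ι (suc d ℕ.+ suc e) * (c * c′)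
    coefficient = begin
      (ι (suc d) * c) * c′ + c * (ι (suc e) * c′)
        ≡⟨ solve 4 (λ i j c c′ → (i :* c) :* c′ :+ c :* (j :* c′) := (i :+ j) :* (c :* c′)) refl
             (ι (suc d)) (ι (suc e)) c c′ ⟩
      (ι (suc d) + ι (suc e)) * (c * c′)
        ≡⟨ cong (_* (c * c′)) (×-homo-+ 1# (suc d) (suc e)) ⟨
      ι (suc d ℕ.+ suc e) * (c * c′) ∎

  Lead-^ : ∀ k {d c g} → Lead d c g → Lead (k ℕ.* d) (c ^ k) (λ x → g x ^ k)
  Lead-^ zero        l = λ _ → refl
  Lead-^ (suc k) {d} l = Lead-* d (k ℕ.* d) l (Lead-^ k l)

  Lead-id : Lead 1 1# id
  Lead-id x = solve 2 (λ o x → (o :+ x) :- x := (o :+ con (0 , 0)) :* :1) refl 1# x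

  Lead-raise : ∀ n {c g} → Lead n c g → Lead (suc n) 0# g
  Lead-raise zero    {c} l x = trans (cong₂ _-_ (l (1# + x)) (l x)) (trans (-‿inverseʳ c) (sym (zeroʳ _)))
  Lead-raise (suc n) l = Lead-cong (suc n) (sym (zeroʳ _)) (λ _ → refl) (Lead-raise n l)

  Lead-above : ∀ {n m c g} → n < m → Lead n c g → Lead m 0# g
  Lead-above {n} {suc m} (s≤s n≤m) l with ℕ.m≤n⇒m<n∨m≡n n≤m
  ... | inj₁ n<m  = Lead-raise m (Lead-above n<m l)
  ... | inj₂ refl = Lead-raise n l

  Lead⇒Dⁿ : ∀ n {c g} → Lead n c g → ∀ x → Dⁿ n g x ≡ fact n * c
  Lead⇒Dⁿ zero    l x = trans (l x) (sym (*-identityˡ _))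
  Lead⇒Dⁿ (suc n) {c} l x = trans (Lead⇒Dⁿ n l x)
    (solve 3 (λ f i c → f :* (i :* c) := (i :* f) :* c) refl (fact n) (ι (suc n)) c)

  Dⁿ⇒Lead : ∀ n {c g} → (∀ x → Dⁿ n g x ≡ fact n * c) → Lead n c g
  Dⁿ⇒Lead zero    eq x = trans (eq x) (*-identityˡ _)
  Dⁿ⇒Lead (suc n) {c} eq = Dⁿ⇒Lead n λ x → trans (eq x)
    (solve 3 (λ f i c → (i :* f) :* c := f :* (i :* c)) refl (fact n) (ι (suc n)) c)

  -- Binomial expansions.

  ∑< : ℕ → (ℕ → A) → A
  ∑< zero    a = 0#
  ∑< (suc n) a = a 0 + ∑< n (a ∘ suc)

  ∑<-cong : ∀ n {a b} → (∀ i → i < n → a i ≡ b i) → ∑< n a ≡ ∑< n b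
  ∑<-cong zero    eq = refl
  ∑<-cong (suc n) eq = cong₂ _+_ (eq 0 (s≤s z≤n)) (∑<-cong n λ i i<n → eq (suc i) (s≤s i<n))

  ∑<-last : ∀ n a → ∑< (suc n) a ≡ ∑< n a + a n
  ∑<-last zero    a = +-comm _ _
  ∑<-last (suc n) a = trans (cong (a 0 +_) (∑<-last n (a ∘ suc))) (sym (+-assoc _ _ _))

  ∑<-linear : ∀ n f y a b → ∑< n (λ i → f * a i + y * b i) ≡ f * ∑< n a + y * ∑< n b
  ∑<-linear zero    f y a b =
    solve 2 (λ f y → con (0 , 0) := f :* con (0 , 0) :+ y :* con (0 , 0)) refl f y
  ∑<-linear (suc n) f y a b = trans (cong ((f * a 0 + y * b 0) +_) (∑<-linear n f y (a ∘ suc) (b ∘ suc)))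
    (solve 6 (λ f y a₀ b₀ s t → (f :* a₀ :+ y :* b₀) :+ (f :* s :+ y :* t)
                             := f :* (a₀ :+ s) :+ y :* (b₀ :+ t)) refl
      f y (a 0) (b 0) (∑< n (a ∘ suc)) (∑< n (b ∘ suc)))

  -- The coefficient of cⁱ in (f + y c)ⁿ.
  coeff : A → A → ℕ → ℕ → A
  coeff f y zero    zero    = 1#
  coeff f y zero    (suc i) = 0#
  coeff f y (suc n) zero    = f * coeff f y n zero
  coeff f y (suc n) (suc i) = f * coeff f y n (suc i) + y * coeff f y n i

  coeff-overflow : ∀ f y {n i} → n < i → coeff f y n i ≡ 0#
  coeff-overflow f y {zero}  {suc i} _         = refl
  coeff-overflow f y {suc n} {suc i} (s≤s n<i) = trans
    (cong₂ (λ a b → f * a + y * b) (coeff-overflow f y (ℕ.m≤n⇒m≤1+n n<i)) (coeff-overflow f y n<i))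
    (solve 2 (λ f y → f :* con (0 , 0) :+ y :* con (0 , 0) := con (0 , 0)) refl f y)

  -- One binomial theorem for powers of f + y c (W n m = (f + y c)ⁿ cᵐ) and for
  -- iterated differences (f = −1, y = 1, W n m = Dⁿ n g (ι m)).
  umbral-expansion : ∀ f y (W : ℕ → ℕ → A) → (∀ n m → W (suc n) m ≡ f * W n m + y * W n (suc m)) →
    ∀ n → W n 0 ≡ ∑< (suc n) (λ i → coeff f y n i * W 0 i)
  umbral-expansion f y W step zero = solve 1 (λ w → w := :1 :* w :+ con (0 , 0)) refl (W 0 0)
  umbral-expansion f y W step (suc n) = begin
    W (suc n) 0
      ≡⟨ umbral-expansion f y (W ∘ suc) (step ∘ suc) n ⟩
    ∑< (suc n) (λ i → C n i * W 1 i)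
      ≡⟨ ∑<-cong (suc n) (λ i _ → trans (cong (C n i *_) (step 0 i))
           (solve 5 (λ c f y u v → c :* (f :* u :+ y :* v) := f :* (c :* u) :+ y :* (c :* v)) refl
             (C n i) f y (W 0 i) (W 0 (suc i)))) ⟩
    ∑< (suc n) (λ i → f * (C n i * W 0 i) + y * (C n i * W 0 (suc i)))
      ≡⟨ ∑<-linear (suc n) f y (λ i → C n i * W 0 i) (λ i → C n i * W 0 (suc i)) ⟩
    f * ∑< (suc n) (λ i → C n i * W 0 i) + y * T
      ≡⟨ cong (λ s → f * s + y * T) extend ⟩
    f * (C n 0 * W 0 0 + S) + y * T
      ≡⟨ solve 6 (λ f y c w s t → f :* (c :* w :+ s) :+ y :* t := (f :* c) :* w :+ (f :* s :+ y :* t)) refl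
           f y (C n 0) (W 0 0) S T ⟩
    (f * C n 0) * W 0 0 + (f * S + y * T)
      ≡⟨ cong ((f * C n 0) * W 0 0 +_) (∑<-linear (suc n) f y (λ i → C n (suc i) * W 0 (suc i))
           (λ i → C n i * W 0 (suc i))) ⟨
    (f * C n 0) * W 0 0 + ∑< (suc n) (λ i → f * (C n (suc i) * W 0 (suc i)) + y * (C n i * W 0 (suc i)))
      ≡⟨ cong ((f * C n 0) * W 0 0 +_) (∑<-cong (suc n) λ i _ →
           solve 5 (λ f y c c′ w → f :* (c :* w) :+ y :* (c′ :* w) := (f :* c :+ y :* c′) :* w) refl
             f y (C n (suc i)) (C n i) (W 0 (suc i))) ⟩
    ∑< (suc (suc n)) (λ i → C (suc n) i * W 0 i) ∎
    where
    C = coeff f y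
    S = ∑< (suc n) (λ i → C n (suc i) * W 0 (suc i))
    T = ∑< (suc n) (λ i → C n i * W 0 (suc i))
    extend : ∑< (suc n) (λ i → C n i * W 0 i) ≡ C n 0 * W 0 0 + S
    extend = begin
      ∑< (suc n) (λ i → C n i * W 0 i)
        ≡⟨ solve 2 (λ s w → s := s :+ con (0 , 0) :* w) refl _ (W 0 (suc n)) ⟩
      ∑< (suc n) (λ i → C n i * W 0 i) + 0# * W 0 (suc n)
        ≡⟨ cong (λ c → ∑< (suc n) (λ i → C n i * W 0 i) + c * W 0 (suc n)) (coeff-overflow f y (ℕ.n<1+n n)) ⟨
      ∑< (suc n) (λ i → C n i * W 0 i) + C n (suc n) * W 0 (suc n)
        ≡⟨ ∑<-last (suc n) (λ i → C n i * W 0 i) ⟨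
      C n 0 * W 0 0 + S ∎

  -- binom i j is the binomial coefficient of i + j over i.
  binom : ℕ → ℕ → A
  binom zero    j       = 1#
  binom (suc i) zero    = 1#
  binom (suc i) (suc j) = binom i (suc j) + binom (suc i) j

  binom-zeroʳ : ∀ i → binom i 0 ≡ 1#
  binom-zeroʳ zero    = refl
  binom-zeroʳ (suc i) = refl

  coeff≡binom : ∀ f y i j → coeff f y (i ℕ.+ j) i ≡ binom i j * (y ^ i * f ^ j)
  coeff≡binom f y zero zero = solve 0 (:1 := :1 :* (:1 :* :1)) refl
  coeff≡binom f y zero (suc j) = trans (cong (f *_) (coeff≡binom f y zero j))
    (solve 2 (λ f u → f :* (:1 :* (:1 :* u)) := :1 :* (:1 :* (f :* u))) refl f (f ^ j))
  coeff≡binom f y (suc i) zero = trans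
    (cong₂ (λ a b → f * a + y * b) (coeff-overflow f y (s≤s (ℕ.≤-reflexive (ℕ.+-identityʳ i))))
      (trans (coeff≡binom f y i zero) (cong (_* (y ^ i * 1#)) (binom-zeroʳ i))))
    (solve 3 (λ f y u → f :* con (0 , 0) :+ y :* (:1 :* (u :* :1)) := :1 :* ((y :* u) :* :1)) refl
      f y (y ^ i))
  coeff≡binom f y (suc i) (suc j) = trans
    (cong₂ (λ a b → f * a + y * b)
      (trans (cong (λ n → coeff f y n (suc i)) (ℕ.+-suc i j)) (coeff≡binom f y (suc i) j))
      (coeff≡binom f y i (suc j)))
    (solve 6 (λ f y a b u v → f :* (a :* ((y :* u) :* v)) :+ y :* (b :* (u :* (f :* v)))
                           := (b :+ a) :* ((y :* u) :* (f :* v))) refl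
      f y (binom (suc i) j) (binom i (suc j)) (y ^ i) (f ^ j))

  -- The factorial formula without division; over ℤ/p both the vanishing and the nonvanishing of
  -- binomial coefficients are read off it.
  binom-fact : ∀ i j → binom i j * (fact i * fact j) ≡ fact (i ℕ.+ j)
  binom-fact zero j = solve 1 (λ u → :1 :* (:1 :* u) := u) refl (fact j)
  binom-fact (suc i) zero = trans (solve 1 (λ u → :1 :* (u :* :1) := u) refl (fact (suc i)))
    (cong fact (sym (ℕ.+-identityʳ (suc i))))
  binom-fact (suc i) (suc j) = begin
    (binom i (suc j) + binom (suc i) j) * (fact (suc i) * fact (suc j))
      ≡⟨ solve 6 (λ a b m n u v → (a :+ b) :* ((m :* u) :* (n :* v))
                              := m :* (a :* (u :* (n :* v))) :+ n :* (b :* ((m :* u) :* v))) refl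
           (binom i (suc j)) (binom (suc i) j) (ι (suc i)) (ι (suc j)) (fact i) (fact j) ⟩
    ι (suc i) * (binom i (suc j) * (fact i * fact (suc j)))
      + ι (suc j) * (binom (suc i) j * (fact (suc i) * fact j))
      ≡⟨ cong₂ (λ s t → ι (suc i) * s + ι (suc j) * t) (binom-fact i (suc j))
           (trans (binom-fact (suc i) j) (cong fact (sym (ℕ.+-suc i j)))) ⟩
    ι (suc i) * fact (i ℕ.+ suc j) + ι (suc j) * fact (i ℕ.+ suc j)
      ≡⟨ distribʳ _ _ _ ⟨
    (ι (suc i) + ι (suc j)) * fact (i ℕ.+ suc j)
      ≡⟨ cong (_* fact (i ℕ.+ suc j)) (×-homo-+ 1# (suc i) (suc j)) ⟨
    fact (suc i ℕ.+ suc j) ∎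

  -- Polynomials given by coefficient sequences, and division by a linear factor.

  eval : ℕ → (ℕ → A) → A → A
  eval zero    a c = 0#
  eval (suc n) a c = a 0 + c * eval n (a ∘ suc) c

  eval-∑< : ∀ n a c → ∑< n (λ i → a i * c ^ i) ≡ eval n a c
  eval-∑< zero    a c = refl
  eval-∑< (suc n) a c = cong₂ _+_ (*-identityʳ _) (begin
    ∑< n (λ i → a (suc i) * (c * c ^ i))
      ≡⟨ ∑<-cong n (λ i _ → solve 3 (λ a c u → a :* (c :* u) := c :* (a :* u) :+ con (0 , 0) :* (a :* u)) refl
           (a (suc i)) c (c ^ i)) ⟩
    ∑< n (λ i → c * (a (suc i) * c ^ i) + 0# * (a (suc i) * c ^ i))
      ≡⟨ ∑<-linear n c 0# _ _ ⟩
    c * ∑< n (λ i → a (suc i) * c ^ i) + 0# * ∑< n (λ i → a (suc i) * c ^ i)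
      ≡⟨ solve 2 (λ c s → c :* s :+ con (0 , 0) :* s := c :* s) refl c _ ⟩
    c * ∑< n (λ i → a (suc i) * c ^ i)
      ≡⟨ cong (c *_) (eval-∑< n (a ∘ suc) c) ⟩
    c * eval n (a ∘ suc) c ∎)

  -- Synthetic division by c - u of the polynomial with the `suc n` coefficients a 0 , ... , a n:
  -- coefficient i of the quotient is the Horner value at u of the coefficients above i.
  quotient : ℕ → (ℕ → A) → A → ℕ → A
  quotient n       a u zero    = eval n (a ∘ suc) u
  quotient zero    a u (suc i) = 0#
  quotient (suc n) a u (suc i) = quotient n (a ∘ suc) u i

  quotient-correct : ∀ n a u c →
    eval (suc n) a c - eval (suc n) a u ≡ (c - u) * eval n (quotient n a u) c
  quotient-correct zero a u c =
    solve 3 (λ a u c → (a :+ c :* con (0 , 0)) :- (a :+ u :* con (0 , 0)) := (c :- u) :* con (0 , 0)) refl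
      (a 0) u c
  quotient-correct (suc n) a u c = begin
    (a 0 + c * Ec) - (a 0 + u * Eu)
      ≡⟨ solve 5 (λ a c u x y → (a :+ c :* x) :- (a :+ u :* y) := (c :- u) :* y :+ c :* (x :- y)) refl
           (a 0) c u Ec Eu ⟩
    (c - u) * Eu + c * (Ec - Eu)
      ≡⟨ cong (λ s → (c - u) * Eu + c * s) (quotient-correct n (a ∘ suc) u c) ⟩
    (c - u) * Eu + c * ((c - u) * Q)
      ≡⟨ solve 4 (λ c u y q → (c :- u) :* y :+ c :* ((c :- u) :* q) := (c :- u) :* (y :+ c :* q)) refl
           c u Eu Q ⟩
    (c - u) * (Eu + c * Q) ∎
    where
    Ec = eval (suc n) (a ∘ suc) c
    Eu = eval (suc n) (a ∘ suc) u
    Q  = eval n (quotient n (a ∘ suc) u) c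

  quotient-step : ∀ n a u i → i < n → quotient n a u i ≡ a (suc i) + u * quotient n a u (suc i)
  quotient-step (suc n) a u zero    _         = refl
  quotient-step (suc n) a u (suc i) (s≤s i<n) = quotient-step n (a ∘ suc) u i i<n

  quotient-end : ∀ n a u → quotient n a u n ≡ 0#
  quotient-end zero    a u = refl
  quotient-end (suc n) a u = quotient-end n (a ∘ suc) u

  eval-zero : ∀ n a u → (∀ i → i < n → a i ≡ 0#) → eval n a u ≡ 0#
  eval-zero zero    a u a≡0 = refl
  eval-zero (suc n) a u a≡0 = trans
    (cong₂ (λ s t → s + u * t) (a≡0 0 (s≤s z≤n)) (eval-zero n (a ∘ suc) u (λ i i<n → a≡0 (suc i) (s≤s i<n))))
    (solve 1 (λ u → con (0 , 0) :+ u :* con (0 , 0) := con (0 , 0)) refl u)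

  -- The recurrence q i = a (i + 1) + u q (i + 1) returns every coefficient except the constant one,
  -- which the root then forces to be 0.
  quotient-zero : ∀ n a u → eval (suc n) a u ≡ 0# → (∀ i → i < n → quotient n a u i ≡ 0#) →
    ∀ i → i < suc n → a i ≡ 0#
  quotient-zero n a u root q≡0 (suc i) (s≤s i<n) = begin
    a (suc i)                                ≡⟨ solve 2 (λ a u → a := a :+ u :* con (0 , 0)) refl _ u ⟩
    a (suc i) + u * 0#                       ≡⟨ cong (λ q → a (suc i) + u * q) next ⟨
    a (suc i) + u * quotient n a u (suc i)   ≡⟨ quotient-step n a u i i<n ⟨
    quotient n a u i                         ≡⟨ q≡0 i i<n ⟩
    0#                                       ∎
    where
    next : quotient n a u (suc i) ≡ 0#
    next with ℕ.m≤n⇒m<n∨m≡n i<n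
    ... | inj₁ 1+i<n = q≡0 (suc i) 1+i<n
    ... | inj₂ refl  = quotient-end n a u
  quotient-zero n a u root q≡0 zero _ = begin
    a 0                              ≡⟨ solve 2 (λ a u → a := a :+ u :* con (0 , 0)) refl _ u ⟩
    a 0 + u * 0#                     ≡⟨ cong (λ e → a 0 + u * e) (eval-zero n (a ∘ suc) u
                                          (λ i i<n → quotient-zero n a u root q≡0 (suc i) (s≤s i<n))) ⟨
    a 0 + u * eval n (a ∘ suc) u     ≡⟨ root ⟩
    0#                               ∎

-- Finite integral domains.

module FiniteDomain {n} {_⊕_ _⊗_ : Op₂ (Fin n)} {⊖_ : Op₁ (Fin n)} {𝟘 𝟙 : Fin n}
  (isCommutativeRing : IsCommutativeRing _≡_ _⊕_ _⊗_ ⊖_ 𝟘 𝟙)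
  (domain : ∀ x y → x ⊗ y ≡ 𝟘 → x ≡ 𝟘 ⊎ y ≡ 𝟘) where

  open FiniteDifferences isCommutativeRing
  open ≡-Reasoning

  difference-zero : ∀ {x y} → x - y ≡ 0# → x ≡ y
  difference-zero {x} {y} eq = begin
    x            ≡⟨ solve 2 (λ x y → x := (x :- y) :+ y) refl x y ⟩
    (x - y) + y  ≡⟨ cong (_+ y) eq ⟩
    0# + y       ≡⟨ +-identityˡ y ⟩
    y            ∎

  *-nonzero : ∀ {x y} → x ≢ 0# → y ≢ 0# → x * y ≢ 0#
  *-nonzero {x} {y} x≢0 y≢0 xy≡0 = Sum.[ x≢0 , y≢0 ]′ (domain x y xy≡0)

  factor-zero : ∀ {x y} → x ≢ 0# → x * y ≡ 0# → y ≡ 0#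
  factor-zero {x} {y} x≢0 xy≡0 = Sum.[ (λ x≡0 → contradiction x≡0 x≢0) , id ]′ (domain x y xy≡0)

  *-cancelˡ-nonzero : ∀ {x y z} → x ≢ 0# → x * y ≡ x * z → y ≡ z
  *-cancelˡ-nonzero {x} {y} {z} x≢0 eq = difference-zero (factor-zero x≢0 (begin
    x * (y - z)     ≡⟨ solve 3 (λ x y z → x :* (y :- z) := x :* y :- x :* z) refl x y z ⟩
    x * y - x * z   ≡⟨ cong (_- x * z) eq ⟩
    x * z - x * z   ≡⟨ -‿inverseʳ _ ⟩
    0#              ∎))

  inverse : ∀ {x} → x ≢ 0# → ∃ λ y → x * y ≡ 1#
  inverse {x} x≢0 = injective⇒surjective {f = x *_} (*-cancelˡ-nonzero x≢0) 1#

-- If j + l > h, doubling gives j + 2 l ≥ l d + 2, so j ≥ l (d - 2) + 2 ≥ d because l ≥ 1, against j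
-- < d.
degree-bound : ∀ h d j l → 2 ≤ d → 1 ≤ l → j < d → j ℕ.+ l ℕ.* d ≡ h ℕ.+ h → j ℕ.+ l ≤ h
degree-bound h (suc zero) j l (s≤s ()) _ _ _
degree-bound h (suc (suc e)) j l _ 1≤l (s≤s j≤1+e) eq with j ℕ.+ l ℕ.≤? h
... | yes j+l≤h = j+l≤h
... | no  j+l≰h = contradiction (ℕ.≤-trans 2+e≤j j≤1+e) ℕ.1+n≰n
  where
  open ℕ.≤-Reasoning
  2+e≤j : suc (suc e) ≤ j
  2+e≤j = ℕ.+-cancelˡ-≤ (j ℕ.+ (l ℕ.+ l)) (suc (suc e)) j (begin
    j ℕ.+ (l ℕ.+ l) ℕ.+ suc (suc e)
      ≤⟨ ℕ.+-monoʳ-≤ (j ℕ.+ (l ℕ.+ l)) (s≤s (s≤s (ℕ.m≤n*m e l {{ℕ.>-nonZero 1≤l}}))) ⟩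
    j ℕ.+ (l ℕ.+ l) ℕ.+ suc (suc (l ℕ.* e))
      ≡⟨ +-*-Solver.solve 3 (λ j l e → let open +-*-Solver in
           j :+ (l :+ l) :+ (con 2 :+ l :* e) := con 2 :+ (j :+ l :* (con 2 :+ e))) refl j l e ⟩
    2 ℕ.+ (j ℕ.+ l ℕ.* suc (suc e))
      ≡⟨ cong (2 ℕ.+_) eq ⟩
    2 ℕ.+ (h ℕ.+ h)
      ≡⟨ cong suc (ℕ.+-suc h h) ⟨
    suc h ℕ.+ suc h
      ≤⟨ ℕ.+-mono-≤ (ℕ.≰⇒> j+l≰h) (ℕ.≰⇒> j+l≰h) ⟩
    j ℕ.+ l ℕ.+ (j ℕ.+ l)
      ≡⟨ +-*-Solver.solve 2 (λ j l → let open +-*-Solver in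
           j :+ l :+ (j :+ l) := j :+ (l :+ l) :+ j) refl j l ⟩
    j ℕ.+ (l ℕ.+ l) ℕ.+ j ∎)

-- Functions on the field with p = 2 h + 1 elements.

module OddPrimeField (h : ℕ) (1≤h : 1 ≤ h)
  {_⊕_ _⊗_ : Op₂ (Fin (suc (h ℕ.+ h)))} {⊖_ : Op₁ (Fin (suc (h ℕ.+ h)))} {𝟘 𝟙 : Fin (suc (h ℕ.+ h))}
  (isCommutativeRing : IsCommutativeRing _≡_ _⊕_ _⊗_ ⊖_ 𝟘 𝟙)
  (ι-toℕ : ∀ x → FiniteDifferences.ι isCommutativeRing (toℕ x) ≡ x)
  (ι-char : FiniteDifferences.ι isCommutativeRing (suc (h ℕ.+ h)) ≡ 𝟘)
  (domain : ∀ x y → x ⊗ y ≡ 𝟘 → x ≡ 𝟘 ⊎ y ≡ 𝟘) where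

  open FiniteDifferences isCommutativeRing
  open Algebra.Properties.Semiring.Sum (CommutativeRing.semiring ring)
    using (sum; sum-cong-≗; ∑-distrib-+; *-distribˡ-sum; *-distribʳ-sum; sum-permute; sum-replicate-zero)
  open ≡-Reasoning

  open FiniteDomain isCommutativeRing domain

  p : ℕ
  p = suc (h ℕ.+ h)

  F : Set
  F = Fin p

  ^-zero : ∀ n {x} → x ^ n ≡ 0# → x ≡ 0#
  ^-zero zero    {x} 1≡0 = trans (sym (*-identityˡ x)) (trans (cong (_* x) 1≡0) (zeroˡ x))
  ^-zero (suc n) {x} eq  = Sum.[ id , ^-zero n ]′ (domain x (x ^ n) eq)

  0#≡zero : 0# ≡ zero
  0#≡zero = ι-toℕ zero

  ι-nonzero : ∀ {n} → 1 ≤ n → n < p → ι n ≢ 0#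
  ι-nonzero {suc n} _ n<p ιn≡0 with () ← (begin
    suc n                      ≡⟨ toℕ-fromℕ< n<p ⟨
    toℕ (fromℕ< n<p)           ≡⟨ cong toℕ (ι-toℕ _) ⟨
    toℕ (ι (toℕ (fromℕ< n<p))) ≡⟨ cong (λ m → toℕ (ι m)) (toℕ-fromℕ< n<p) ⟩
    toℕ (ι (suc n))            ≡⟨ cong toℕ (trans ιn≡0 0#≡zero) ⟩
    0                          ∎)

  1≢0 : 1# ≢ 0#
  1≢0 = ι-nonzero (s≤s z≤n) (s≤s (ℕ.≤-trans 1≤h (ℕ.m≤m+n h h))) ∘ trans (+-identityʳ 1#)

  2≢0 : 1# + 1# ≢ 0#
  2≢0 = ι-nonzero (s≤s z≤n) (s≤s (ℕ.+-mono-≤ 1≤h 1≤h)) ∘ trans (cong (1# +_) (+-identityʳ 1#))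

  fact-nonzero : ∀ {n} → n < p → fact n ≢ 0#
  fact-nonzero {zero}  _     = 1≢0
  fact-nonzero {suc n} 1+n<p = *-nonzero (ι-nonzero (s≤s z≤n) 1+n<p) (fact-nonzero (ℕ.≤-trans (ℕ.n≤1+n _) 1+n<p))

  binom-nonzero : ∀ i j → i ℕ.+ j < p → binom i j ≢ 0#
  binom-nonzero i j i+j<p eq = fact-nonzero i+j<p (begin
    fact (i ℕ.+ j)                ≡⟨ binom-fact i j ⟨
    binom i j * (fact i * fact j) ≡⟨ cong (_* (fact i * fact j)) eq ⟩
    0# * (fact i * fact j)        ≡⟨ zeroˡ _ ⟩
    0#                            ∎)

  -- In the factorial formula p! contains the factor `ι p`, which is 0, while the two smaller
  -- factorials are nonzero.
  binom-zero : ∀ i j → suc i ℕ.+ suc j ≡ p → binom (suc i) (suc j) ≡ 0#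
  binom-zero i j eq = factor-zero (*-nonzero (fact-nonzero 1+i<p) (fact-nonzero 1+j<p)) (begin
    fact (suc i) * fact (suc j) * binom (suc i) (suc j)   ≡⟨ *-comm _ (binom (suc i) (suc j)) ⟩
    binom (suc i) (suc j) * (fact (suc i) * fact (suc j)) ≡⟨ binom-fact (suc i) (suc j) ⟩
    fact (suc i ℕ.+ suc j)                                ≡⟨ cong fact eq ⟩
    ι p * fact (h ℕ.+ h)                                  ≡⟨ cong (_* fact (h ℕ.+ h)) ι-char ⟩
    0# * fact (h ℕ.+ h)                                   ≡⟨ zeroˡ _ ⟩
    0#                                                    ∎)
    where
    1+i<p : suc i < p
    1+i<p = subst (suc i <_) eq (s≤s (ℕ.m<m+n i (s≤s z≤n)))
    1+j<p : suc j < p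
    1+j<p = subst (suc j <_) eq (s≤s (ℕ.m≤n+m (suc j) i))

  -- The inner entries of row p of Pascal's triangle vanish, so neighbours in row p - 1 are
  -- negatives of each other; that row is 1, -1, 1, ... and the power of -1 undoes its signs.
  binom-alternating : ∀ i j → i ℕ.+ j ≡ h ℕ.+ h → binom i j * (- 1#) ^ j ≡ 1#
  binom-alternating i zero    eq = trans (*-identityʳ _) (binom-zeroʳ i)
  binom-alternating i (suc j) eq = begin
    binom i (suc j) * (- 1# * (- 1#) ^ j)
      ≡⟨ solve 3 (λ a b u → a :* (:- :1 :* u) := b :* u :- (a :+ b) :* u) refl
           (binom i (suc j)) (binom (suc i) j) ((- 1#) ^ j) ⟩
    binom (suc i) j * (- 1#) ^ j - binom (suc i) (suc j) * (- 1#) ^ j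
      ≡⟨ cong₂ (λ s t → s - t * (- 1#) ^ j) (binom-alternating (suc i) j (trans (sym (ℕ.+-suc i j)) eq))
           (binom-zero i j (cong suc eq)) ⟩
    1# - 0# * (- 1#) ^ j
      ≡⟨ solve 1 (λ u → :1 :- con (0 , 0) :* u := :1) refl _ ⟩
    1# ∎

  sum-toℕ : ∀ n a → sum {n} (λ i → a (toℕ i)) ≡ ∑< n a
  sum-toℕ zero    a = refl
  sum-toℕ (suc n) a = cong (a 0 +_) (sum-toℕ n (a ∘ suc))

  sum-injective : ∀ {f : F → F} → Injective _≡_ _≡_ f → ∀ g → sum (g ∘ f) ≡ sum g
  sum-injective {f} f-inj g = sym (sum-permute g π)
    where
    f⁻¹ = injective⇒surjective f-inj
    π : Permutation′ p
    π = permutation f (proj₁ ∘ f⁻¹) (proj₂ ∘ f⁻¹) (λ x → f-inj (proj₂ (f⁻¹ (f x))))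

  +-cancelˡ′ : ∀ a {x y} → a + x ≡ a + y → x ≡ y
  +-cancelˡ′ a {x} {y} eq = begin
    x             ≡⟨ solve 2 (λ a x → x := (a :+ x) :- a) refl a x ⟩
    (a + x) - a   ≡⟨ cong (_- a) eq ⟩
    (a + y) - a   ≡⟨ solve 2 (λ a x → (a :+ x) :- a := x) refl a y ⟩
    y             ∎

  -- (E − 1)ᵖ⁻¹ = 1 + E + ⋯ + Eᵖ⁻¹ modulo p, for the shift operator E.
  Dᵖ⁻¹≡sum : ∀ g x → Dⁿ (h ℕ.+ h) g x ≡ sum g
  Dᵖ⁻¹≡sum g x = begin
    Dⁿ (h ℕ.+ h) g x
      ≡⟨ cong (Dⁿ (h ℕ.+ h) g) (sym (+-identityˡ x)) ⟩
    Dⁿ (h ℕ.+ h) g (ι 0 + x)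
      ≡⟨ umbral-expansion (- 1#) 1# (λ n m → Dⁿ n g (ι m + x)) step (h ℕ.+ h) ⟩
    ∑< p (λ i → coeff (- 1#) 1# (h ℕ.+ h) i * g (ι i + x))
      ≡⟨ ∑<-cong p (λ i i<p → trans (cong (_* g (ι i + x)) (coeff≡1 i (ℕ.≤-pred i<p))) (*-identityˡ _)) ⟩
    ∑< p (λ i → g (ι i + x))
      ≡⟨ sum-toℕ p (λ i → g (ι i + x)) ⟨
    sum {p} (λ i → g (ι (toℕ i) + x))
      ≡⟨ sum-cong-≗ {p} (λ i → cong g (trans (cong (_+ x) (ι-toℕ i)) (+-comm i x))) ⟩
    sum {p} (λ i → g (x + i))
      ≡⟨ sum-injective (+-cancelˡ′ x) g ⟩
    sum g ∎
    where
    step : ∀ n m → Dⁿ (suc n) g (ι m + x) ≡ - 1# * Dⁿ n g (ι m + x) + 1# * Dⁿ n g (ι (suc m) + x)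
    step n m = begin
      Dⁿ (suc n) g (ι m + x)
        ≡⟨ Dⁿ-suc n g _ ⟩
      Dⁿ n g (1# + (ι m + x)) - Dⁿ n g (ι m + x)
        ≡⟨ cong (λ y → Dⁿ n g y - Dⁿ n g (ι m + x)) (+-assoc 1# (ι m) x) ⟨
      Dⁿ n g (ι (suc m) + x) - Dⁿ n g (ι m + x)
        ≡⟨ solve 2 (λ a b → a :- b := :- :1 :* b :+ :1 :* a) refl _ _ ⟩
      - 1# * Dⁿ n g (ι m + x) + 1# * Dⁿ n g (ι (suc m) + x) ∎
    coeff≡1 : ∀ i → i ≤ h ℕ.+ h → coeff (- 1#) 1# (h ℕ.+ h) i ≡ 1#
    coeff≡1 i i≤ = begin
      coeff (- 1#) 1# (h ℕ.+ h) i         ≡⟨ cong (λ n → coeff (- 1#) 1# n i) (ℕ.m+[n∸m]≡n i≤) ⟨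
      coeff (- 1#) 1# (i ℕ.+ j) i         ≡⟨ coeff≡binom (- 1#) 1# i j ⟩
      binom i j * (1# ^ i * (- 1#) ^ j)   ≡⟨ cong (λ u → binom i j * (u * (- 1#) ^ j)) (1^ i) ⟩
      binom i j * (1# * (- 1#) ^ j)       ≡⟨ cong (binom i j *_) (*-identityˡ _) ⟩
      binom i j * (- 1#) ^ j              ≡⟨ binom-alternating i j (ℕ.m+[n∸m]≡n i≤) ⟩
      1#                                  ∎
      where
      j = h ℕ.+ h ℕ.∸ i

  sum-Lead-top : ∀ {c g} → Lead (h ℕ.+ h) c g → sum g ≡ fact (h ℕ.+ h) * c
  sum-Lead-top {g = g} l = trans (sym (Dᵖ⁻¹≡sum g 0#)) (Lead⇒Dⁿ (h ℕ.+ h) l 0#)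

  sum-Lead-low : ∀ {n c g} → n < h ℕ.+ h → Lead n c g → sum g ≡ 0#
  sum-Lead-low n< l = trans (sum-Lead-top (Lead-above n< l)) (zeroʳ _)

  power-sum : ∀ {k} → k < h ℕ.+ h → sum {p} (_^ k) ≡ 0#
  power-sum {k} k< = sum-Lead-low k< (subst (λ n → Lead n (1# ^ k) (_^ k)) (ℕ.*-identityʳ k) (Lead-^ k Lead-id))

  -- Every function on the field is polynomial of degree at most p - 1: its (p - 1)-st difference is
  -- the constant `sum g`, and (p - 1)! is invertible.
  Lead-exists : ∀ g → ∃ λ c → Lead (h ℕ.+ h) c g
  Lead-exists g with inverse (fact-nonzero (ℕ.n<1+n (h ℕ.+ h)))
  ... | f⁻¹ , ff⁻¹≡1 = f⁻¹ * sum g , Dⁿ⇒Lead (h ℕ.+ h) λ x → begin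
    Dⁿ (h ℕ.+ h) g x                   ≡⟨ Dᵖ⁻¹≡sum g x ⟩
    sum g                              ≡⟨ *-identityˡ _ ⟨
    1# * sum g                         ≡⟨ cong (_* sum g) ff⁻¹≡1 ⟨
    fact (h ℕ.+ h) * f⁻¹ * sum g       ≡⟨ *-assoc _ _ _ ⟩
    fact (h ℕ.+ h) * (f⁻¹ * sum g)     ∎

  D-constant : ∀ {c g} → (∀ x → D g x ≡ c) → ∀ x → g x ≡ g 0# + c * x
  D-constant {c} {g} Dg≡c x = trans (cong g (sym (ι-toℕ x)))
    (trans (along (toℕ x)) (cong (λ y → g 0# + c * y) (ι-toℕ x)))
    where
    along : ∀ n → g (ι n) ≡ g 0# + c * ι n
    along zero    = solve 2 (λ a c → a := a :+ c :* con (0 , 0)) refl (g 0#) c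
    along (suc n) = begin
      g (1# + ι n)                 ≡⟨ solve 2 (λ u v → u := (u :- v) :+ v) refl _ (g (ι n)) ⟩
      D g (ι n) + g (ι n)          ≡⟨ cong₂ _+_ (Dg≡c (ι n)) (along n) ⟩
      c + (g 0# + c * ι n)         ≡⟨ solve 3 (λ c a u → c :+ (a :+ c :* u) := a :+ c :* (:1 :+ u)) refl c (g 0#) (ι n) ⟩
      g 0# + c * (1# + ι n)        ∎

  -- Returning from `D g` to `g` divides the coefficient by the degree, which is invertible below p.
  Lead-lower : ∀ {n g} → suc n < p → Lead (suc n) 0# g → ∃ λ c → Lead n c g
  Lead-lower {zero} {g} _ l = g 0# , λ x → trans (D-constant (λ y → trans (l y) (zeroʳ _)) x)
    (solve 2 (λ a x → a :+ con (0 , 0) :* x := a) refl (g 0#) x)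
  Lead-lower {suc n} {g} n<p l
    with Lead-lower {n} (ℕ.≤-trans (ℕ.n≤1+n _) n<p) (Lead-cong (suc n) (zeroʳ _) (λ _ → refl) l)
       | inverse (ι-nonzero {suc n} (s≤s z≤n) (ℕ.≤-trans (ℕ.n≤1+n _) n<p))
  ... | c , l′ | i , ιi≡1 = i * c , Lead-cong n (begin
    c                      ≡⟨ *-identityˡ c ⟨
    1# * c                 ≡⟨ cong (_* c) ιi≡1 ⟨
    ι (suc n) * i * c      ≡⟨ *-assoc _ _ _ ⟩
    ι (suc n) * (i * c)    ∎) (λ _ → refl) l′

  -- The bound `h` fits both ends: at least `h` slopes are available to prove these identities, and
  -- by `degree-bound` no larger exponents are called for.
  Moments : (F → F) → Set
  Moments g = ∀ i j → 1 ≤ j → i ℕ.+ j ≤ h → sum {p} (λ x → x ^ i * g x ^ j) ≡ 0#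

  -- Divide p - 1 by the degree d with remainder: p - 1 = j + l d. Then xʲ g(x)ˡ has coefficient cˡ
  -- in degree p - 1, so its sum over the field is (p - 1)! cˡ. This sum is one of the vanishing
  -- moments, hence cˡ = 0.
  moments⇒coefficient-zero : ∀ {g n c} → Moments g → 2 ≤ n → n ≤ h ℕ.+ h → Lead n c g → c ≡ 0#
  moments⇒coefficient-zero {g} {d@(suc _)} {c} moments 2≤d d≤ lead = ^-zero l (begin
    c ^ l              ≡⟨ *-identityˡ _ ⟨
    1# * c ^ l         ≡⟨ cong (_* c ^ l) (1^ j) ⟨
    1# ^ j * c ^ l     ≡⟨ *-cancelˡ-nonzero (fact-nonzero (ℕ.n<1+n (h ℕ.+ h))) (begin
      fact (h ℕ.+ h) * (1# ^ j * c ^ l)    ≡⟨ sum-Lead-top product ⟨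
      sum {p} (λ x → x ^ j * g x ^ l)      ≡⟨ moments j l 1≤l (degree-bound h d j l 2≤d 1≤l j<d decomposition) ⟩
      0#                                   ≡⟨ zeroʳ _ ⟨
      fact (h ℕ.+ h) * 0#                  ∎) ⟩
    0#                 ∎)
    where
    j = (h ℕ.+ h) % d
    l = (h ℕ.+ h) / d
    j<d : j < d
    j<d = m%n<n (h ℕ.+ h) d
    decomposition : j ℕ.+ l ℕ.* d ≡ h ℕ.+ h
    decomposition = sym (m≡m%n+[m/n]*n (h ℕ.+ h) d)
    1≤l : 1 ≤ l
    1≤l with l | decomposition
    ... | zero  | eq = contradiction (subst (_< d) (trans (sym (ℕ.+-identityʳ j)) eq) j<d) (ℕ.≤⇒≯ d≤)
    ... | suc _ | _  = s≤s z≤n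
    product : Lead (h ℕ.+ h) (1# ^ j * c ^ l) (λ x → x ^ j * g x ^ l)
    product = subst (λ n → Lead n (1# ^ j * c ^ l) (λ x → x ^ j * g x ^ l))
      (trans (cong (ℕ._+ l ℕ.* d) (ℕ.*-identityʳ j)) decomposition)
      (Lead-* (j ℕ.* 1) (l ℕ.* d) (Lead-^ j Lead-id) (Lead-^ l lead))

  moments⇒affine : ∀ {g} → Moments g → ∃₂ λ a b → ∀ x → g x ≡ a + b * x
  moments⇒affine {g} moments = descend (h ℕ.+ h) (ℕ.≤-trans 1≤h (ℕ.m≤m+n h h)) ℕ.≤-refl (proj₂ (Lead-exists g))
    where
    descend : ∀ n {c} → 1 ≤ n → n ≤ h ℕ.+ h → Lead n c g → ∃₂ λ a b → ∀ x → g x ≡ a + b * x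
    descend (suc zero)    _ _  l = g 0# , _ , D-constant l
    descend (suc (suc n)) _ n≤ l = descend (suc n) (s≤s z≤n) (ℕ.≤-trans (ℕ.n≤1+n _) n≤)
      (proj₂ (Lead-lower (s≤s n≤) (subst (λ c → Lead (suc (suc n)) c g)
        (moments⇒coefficient-zero moments (s≤s (s≤s z≤n)) n≤ l) l)))

  -- The usual root count, by parameters instead of values. As `u` identifies t with at most `τ t`,
  -- dividing out the root `u t` uses up at most two parameters, and n coefficients require 2 n of
  -- them. How many distinct values `u` takes never has to be known.
  eval-roots : (u τ : F → F) (P : F → Set) →
    (∀ {s t} → P s → P t → u s ≡ u t → s ≡ t ⊎ s ≡ τ t) →
    ∀ n a (ts : List F) → Unique ts → n ℕ.+ n ≤ length ts →
    (∀ {t} → t List.∈ ts → P t × eval n a (u t) ≡ 0#) →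
    ∀ i → i < n → a i ≡ 0#
  eval-roots u τ P two-to-one (suc n) a (t ∷ ts) (t∉ts ∷ ts!) (s≤s len) root
    with remove-one _≟_ (τ t) ts!
  ... | rs , rs! , rs⊆ , len′ = quotient-zero n a (u t) (proj₂ (root (here refl)))
    (eval-roots u τ P two-to-one n (quotient n a (u t)) rs rs!
      (ℕ.≤-pred (ℕ.≤-trans (subst (_≤ length ts) (ℕ.+-suc n n) len) len′))
      (λ {s} s∈rs → let s∈ts , s≢τt = rs⊆ s∈rs ; Ps , as≡0 = root (there s∈ts) in Ps , quotient-root s∈ts s≢τt Ps as≡0))
    where
    quotient-root : ∀ {s} → s List.∈ ts → s ≢ τ t → P s → eval (suc n) a (u s) ≡ 0# →
      eval n (quotient n a (u t)) (u s) ≡ 0#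
    quotient-root {s} s∈ts s≢τt Ps as≡0 with domain (u s - u t) (eval n (quotient n a (u t)) (u s)) (begin
        (u s - u t) * eval n (quotient n a (u t)) (u s)  ≡⟨ quotient-correct n a (u t) (u s) ⟨
        eval (suc n) a (u s) - eval (suc n) a (u t)      ≡⟨ cong₂ _-_ as≡0 (proj₂ (root (here refl))) ⟩
        0# - 0#                                          ≡⟨ -‿inverseʳ 0# ⟩
        0#                                               ∎)
    ... | inj₂ eq = eq
    ... | inj₁ us-ut≡0 with two-to-one Ps (proj₁ (root (here refl))) (difference-zero us-ut≡0)
    ...   | inj₁ s≡t  = ⊥-elim (All.lookup t∉ts s∈ts (sym s≡t))
    ...   | inj₂ s≡τt = ⊥-elim (s≢τt s≡τt)

  nonzero-elements : List F
  nonzero-elements = map suc (allFin (h ℕ.+ h))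

  nonzero-elements-unique : Unique nonzero-elements
  nonzero-elements-unique = map⁺ suc-injective (allFin⁺ (h ℕ.+ h))

  length-nonzero-elements : length nonzero-elements ≡ h ℕ.+ h
  length-nonzero-elements = trans (length-map suc (allFin (h ℕ.+ h))) (length-tabulate id)

  ∈-nonzero-elements⇒≢0 : ∀ {x} → x List.∈ nonzero-elements → x ≢ 0#
  ∈-nonzero-elements⇒≢0 x∈ x≡0 with ∈-map⁻ suc x∈
  ... | _ , _ , x≡suc with () ← trans (sym x≡suc) (trans x≡0 0#≡zero)

  -- Slopes c with c² + 1 a square.

  reciprocal : F → F
  reciprocal x with x ≟ 0#
  ... | yes _  = 0#
  ... | no x≢0 = proj₁ (inverse x≢0)

  *-reciprocal : ∀ {x} → x ≢ 0# → x * reciprocal x ≡ 1#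
  *-reciprocal {x} x≢0 with x ≟ 0#
  ... | yes x≡0 = ⊥-elim (x≢0 x≡0)
  ... | no x≢0′ = proj₂ (inverse x≢0′)

  ½ : F
  ½ = reciprocal (1# + 1#)

  -- The hyperbola v² − c² = 1 is parametrised by v + c = t.
  hyperbola : F → F
  hyperbola t = (t - reciprocal t) * ½

  hyperbola-square : ∀ {t} → t ≢ 0# →
    hyperbola t * hyperbola t + 1# ≡ (t + reciprocal t) * ½ * ((t + reciprocal t) * ½)
  hyperbola-square {t} t≢0 = begin
    (t - r) * ½ * ((t - r) * ½) + 1#
      -- Writing 1 as t r (2 · ½)² turns the claim into the identity (t - r)² + 4 t r = (t + r)².
      ≡⟨ cong ((t - r) * ½ * ((t - r) * ½) +_) (begin
           1#                            ≡⟨ solve 0 (:1 := :1 :* (:1 :* :1)) refl ⟩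
           1# * (1# * 1#)                ≡⟨ cong₂ (λ a b → a * (b * b)) (*-reciprocal t≢0) (*-reciprocal 2≢0) ⟨
           t * r * ((1# + 1#) * ½ * ((1# + 1#) * ½))  ∎) ⟩
    (t - r) * ½ * ((t - r) * ½) + t * r * ((1# + 1#) * ½ * ((1# + 1#) * ½))
      ≡⟨ solve 3 (λ t r h → (t :- r) :* h :* ((t :- r) :* h) :+ t :* r :* (:2 :* h :* (:2 :* h))
                         := (t :+ r) :* h :* ((t :+ r) :* h)) refl t r ½ ⟩
    (t + r) * ½ * ((t + r) * ½) ∎
    where
    r = reciprocal t

  -- The two values differ by ½ (s - t) (1 + 1 / (s t)), so either s = t or s t = -1.
  hyperbola-two-to-one : ∀ {s t} → s ≢ 0# → t ≢ 0# → hyperbola s ≡ hyperbola t → s ≡ t ⊎ s ≡ - reciprocal t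
  hyperbola-two-to-one {s} {t} s≢0 t≢0 eq = Sum.map difference-zero reciprocals (domain (s - t) (1# + s′ * t′) (begin
    (s - t) * (1# + s′ * t′)
      ≡⟨ solve 4 (λ s t s′ t′ → (s :- t) :* (:1 :+ s′ :* t′)
                             := (s :- (s′ :* (t :* t′))) :- (t :- (t′ :* (s :* s′)))) refl s t s′ t′ ⟩
    (s - s′ * (t * t′)) - (t - t′ * (s * s′))
      ≡⟨ cong₂ (λ a b → (s - s′ * a) - (t - t′ * b)) (*-reciprocal t≢0) (*-reciprocal s≢0) ⟩
    (s - s′ * 1#) - (t - t′ * 1#)
      ≡⟨ cong₂ (λ a b → (s - a) - (t - b)) (*-identityʳ s′) (*-identityʳ t′) ⟩
    (s - s′) - (t - t′)
      ≡⟨ cong (_- (t - t′)) (*-cancelˡ-nonzero ½≢0 (trans (*-comm ½ _) (trans eq (*-comm _ ½)))) ⟩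
    (t - t′) - (t - t′)
      ≡⟨ -‿inverseʳ _ ⟩
    0# ∎))
    where
    s′ = reciprocal s
    t′ = reciprocal t
    ½≢0 : ½ ≢ 0#
    ½≢0 ½≡0 = 1≢0 (trans (sym (*-reciprocal 2≢0)) (trans (cong ((1# + 1#) *_) ½≡0) (zeroʳ _)))
    reciprocals : 1# + s′ * t′ ≡ 0# → s ≡ - t′
    reciprocals 1+s′t′≡0 = difference-zero (begin
      s - - t′                   ≡⟨ solve 2 (λ s t′ → s :- :- t′ := s :+ t′ :* :1) refl s t′ ⟩
      s + t′ * 1#                ≡⟨ cong (λ a → s + t′ * a) (*-reciprocal s≢0) ⟨
      s + t′ * (s * s′)          ≡⟨ solve 3 (λ s s′ t′ → s :+ t′ :* (s :* s′) := s :* (:1 :+ s′ :* t′)) refl s s′ t′ ⟩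
      s * (1# + s′ * t′)         ≡⟨ cong (s *_) 1+s′t′≡0 ⟩
      s * 0#                     ≡⟨ zeroʳ s ⟩
      0#                         ∎)

  sum-∑< : ∀ n (f : F → ℕ → F) → sum {p} (λ x → ∑< n (f x)) ≡ ∑< n (λ i → sum {p} (λ x → f x i))
  sum-∑< zero    f = sum-replicate-zero p
  sum-∑< (suc n) f = trans (∑-distrib-+ {p} (λ x → f x 0) (λ x → ∑< n (f x ∘ suc)))
    (cong (sum {p} (λ x → f x 0) +_) (sum-∑< n (λ x → f x ∘ suc)))

  -- With k = i + j, the sum of (g x + x c)ᵏ is a polynomial in c with coefficients `m r`. At a
  -- slope c of the hyperbola it is the sum of all k-th powers, since x ↦ g x + x c permutes the
  -- field, and that is 0 for k < p - 1. The 2 h ≥ 2 k parameters t make all coefficients vanish;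
  -- the i-th is the moment times a nonzero binomial coefficient.
  injective⇒moments : ∀ g →
    (∀ c v → c * c + 1# ≡ v * v → Injective _≡_ _≡_ (λ x → g x + x * c)) → Moments g
  injective⇒moments g injective i j@(suc _) _ i+j≤h =
    *-cancelˡ-nonzero (binom-nonzero i j (s≤s (ℕ.≤-trans i+j≤h (ℕ.m≤m+n h h)))) (begin
      binom i j * sum {p} (λ x → x ^ i * g x ^ j)     ≡⟨ *-distribˡ-sum {p} (binom i j) (λ x → x ^ i * g x ^ j) ⟩
      sum {p} (λ x → binom i j * (x ^ i * g x ^ j))   ≡⟨ sum-cong-≗ {p} (λ x → coeff≡binom (g x) x i j) ⟨
      m i                                             ≡⟨ m-zero ⟩
      0#                                              ≡⟨ zeroʳ _ ⟨
      binom i j * 0#                                  ∎)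
    where
    k = i ℕ.+ j
    m : ℕ → F
    m r = sum {p} (λ x → coeff (g x) x k r)
    k<2h : k < h ℕ.+ h
    k<2h = ℕ.≤-trans (s≤s i+j≤h) (ℕ.+-monoˡ-≤ h 1≤h)
    enough : k ℕ.+ k ≤ length nonzero-elements
    enough = subst (k ℕ.+ k ≤_) (sym length-nonzero-elements) (ℕ.+-mono-≤ i+j≤h i+j≤h)
    -- Without the top coefficient only k remain, which 2 k parameters suffice to kill; with it, 2 k
    -- + 2 would be required, more than there are when k = h.
    m-top : m k ≡ 0#
    m-top = trans (sum-cong-≗ {p} λ x → begin
        coeff (g x) x k k           ≡⟨ cong (λ n → coeff (g x) x n k) (ℕ.+-identityʳ k) ⟨
        coeff (g x) x (k ℕ.+ 0) k   ≡⟨ coeff≡binom (g x) x k 0 ⟩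
        binom k 0 * (x ^ k * 1#)    ≡⟨ cong₂ _*_ (binom-zeroʳ k) (*-identityʳ _) ⟩
        1# * x ^ k                  ≡⟨ *-identityˡ _ ⟩
        x ^ k                       ∎)
      (power-sum k<2h)
    root : ∀ {t} → t ≢ 0# → eval k m (hyperbola t) ≡ 0#
    root {t} t≢0 = begin
      eval k m c
        ≡⟨ eval-∑< k m c ⟨
      ∑< k (λ r → m r * c ^ r)
        ≡⟨ solve 2 (λ s w → s := s :+ con (0 , 0) :* w) refl _ (c ^ k) ⟩
      ∑< k (λ r → m r * c ^ r) + 0# * c ^ k
        ≡⟨ cong (λ a → ∑< k (λ r → m r * c ^ r) + a * c ^ k) m-top ⟨
      ∑< k (λ r → m r * c ^ r) + m k * c ^ k
        ≡⟨ ∑<-last k (λ r → m r * c ^ r) ⟨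
      ∑< (suc k) (λ r → m r * c ^ r)
        ≡⟨ ∑<-cong (suc k) {λ r → m r * c ^ r} {λ r → sum {p} (λ x → coeff (g x) x k r * c ^ r)}
             (λ r _ → *-distribʳ-sum {p} (c ^ r) (λ x → coeff (g x) x k r)) ⟩
      ∑< (suc k) (λ r → sum {p} (λ x → coeff (g x) x k r * c ^ r))
        ≡⟨ sum-∑< (suc k) (λ x r → coeff (g x) x k r * c ^ r) ⟨
      sum {p} (λ x → ∑< (suc k) (λ r → coeff (g x) x k r * c ^ r))
        ≡⟨ sum-cong-≗ {p} binomial ⟨
      sum {p} (λ x → (g x + x * c) ^ k)
        ≡⟨ sum-injective (injective c _ (hyperbola-square t≢0)) (_^ k) ⟩
      sum {p} (_^ k)
        ≡⟨ power-sum k<2h ⟩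
      0# ∎
      where
      c = hyperbola t
      binomial : ∀ x → (g x + x * c) ^ k ≡ ∑< (suc k) (λ r → coeff (g x) x k r * c ^ r)
      binomial x = trans (sym (*-identityʳ _)) (trans (umbral-expansion (g x) x (λ n r → (g x + x * c) ^ n * c ^ r)
          (λ n r → solve 5 (λ f y c u w → ((f :+ y :* c) :* u) :* w := f :* (u :* w) :+ y :* (u :* (c :* w))) refl
            (g x) x c ((g x + x * c) ^ n) (c ^ r)) k)
          (∑<-cong (suc k) (λ r _ → cong (coeff (g x) x k r *_) (*-identityˡ (c ^ r)))))
    m-zero : m i ≡ 0#
    m-zero = eval-roots hyperbola (λ t → - reciprocal t) (_≢ 0#) hyperbola-two-to-one
      k m nonzero-elements nonzero-elements-unique enough
      (λ t∈ → ∈-nonzero-elements⇒≢0 t∈ , root (∈-nonzero-elements⇒≢0 t∈)) i (ℕ.m<m+n i (s≤s z≤n))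

-- Similarities of the plane.

module Similarity (n : ℕ) .{{_ : NonZero n}} where

  open Plane n
  open CommutativeRing (ℤ/ n) using (Carrier; _+_; _*_; _-_; 1#; *-identityˡ)
  open IntegerSolver (ℤ/ n)
  open ≡-Reasoning

  module UnitNorm (A B x₀ y₀ t t⁻¹ : Carrier) (norm : A * A + B * B ≡ t * t) (unit : t * t⁻¹ ≡ 1#) where

    -- Reading (x , y) as x + i y, this is multiplication of the difference from (x₀ , y₀) by the
    -- conjugate A - i B. It turns the direction (A , B) into the first axis and multiplies d² by
    -- the unit square t², so squares stay squares in both directions.
    similarity similarity⁻¹ : Point → Point
    similarity (x , y) = A * (x - x₀) + B * (y - y₀) , A * (y - y₀) - B * (x - x₀)
    similarity⁻¹ (x , y) = x₀ + t⁻¹ * t⁻¹ * (A * x - B * y) , y₀ + t⁻¹ * t⁻¹ * (B * x + A * y)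

    cancel-norm : ∀ x → t⁻¹ * t⁻¹ * ((A * A + B * B) * x) ≡ x
    cancel-norm x = begin
      t⁻¹ * t⁻¹ * ((A * A + B * B) * x)   ≡⟨ cong (λ N → t⁻¹ * t⁻¹ * (N * x)) norm ⟩
      t⁻¹ * t⁻¹ * (t * t * x)             ≡⟨ solve 3 (λ t i x → i :* i :* (t :* t :* x) := t :* i :* (t :* i :* x)) refl t t⁻¹ x ⟩
      t * t⁻¹ * (t * t⁻¹ * x)             ≡⟨ cong (λ u → u * (u * x)) unit ⟩
      1# * (1# * x)                       ≡⟨ trans (*-identityˡ _) (*-identityˡ x) ⟩
      x                                   ∎

    similarity-inverseˡ : ∀ u → similarity⁻¹ (similarity u) ≡ u
    similarity-inverseˡ (x , y) = cong₂ _,_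
      (begin
        _ ≡⟨ solve 7 (λ A B x₀ y₀ i x y →
               x₀ :+ i :* i :* (A :* (A :* (x :- x₀) :+ B :* (y :- y₀)) :- B :* (A :* (y :- y₀) :- B :* (x :- x₀)))
               := x₀ :+ i :* i :* ((A :* A :+ B :* B) :* (x :- x₀))) refl A B x₀ y₀ t⁻¹ x y ⟩
        x₀ + t⁻¹ * t⁻¹ * ((A * A + B * B) * (x - x₀)) ≡⟨ cong (x₀ +_) (cancel-norm (x - x₀)) ⟩
        x₀ + (x - x₀) ≡⟨ solve 2 (λ a x → a :+ (x :- a) := x) refl x₀ x ⟩
        x ∎)
      (begin
        _ ≡⟨ solve 7 (λ A B x₀ y₀ i x y →
               y₀ :+ i :* i :* (B :* (A :* (x :- x₀) :+ B :* (y :- y₀)) :+ A :* (A :* (y :- y₀) :- B :* (x :- x₀)))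
               := y₀ :+ i :* i :* ((A :* A :+ B :* B) :* (y :- y₀))) refl A B x₀ y₀ t⁻¹ x y ⟩
        y₀ + t⁻¹ * t⁻¹ * ((A * A + B * B) * (y - y₀)) ≡⟨ cong (y₀ +_) (cancel-norm (y - y₀)) ⟩
        y₀ + (y - y₀) ≡⟨ solve 2 (λ a x → a :+ (x :- a) := x) refl y₀ y ⟩
        y ∎)

    similarity-inverseʳ : ∀ u → similarity (similarity⁻¹ u) ≡ u
    similarity-inverseʳ (x , y) = cong₂ _,_
      (begin
        _ ≡⟨ solve 7 (λ A B x₀ y₀ i x y →
               A :* ((x₀ :+ i :* i :* (A :* x :- B :* y)) :- x₀) :+ B :* ((y₀ :+ i :* i :* (B :* x :+ A :* y)) :- y₀)
               := i :* i :* ((A :* A :+ B :* B) :* x)) refl A B x₀ y₀ t⁻¹ x y ⟩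
        t⁻¹ * t⁻¹ * ((A * A + B * B) * x) ≡⟨ cancel-norm x ⟩
        x ∎)
      (begin
        _ ≡⟨ solve 7 (λ A B x₀ y₀ i x y →
               A :* ((y₀ :+ i :* i :* (B :* x :+ A :* y)) :- y₀) :- B :* ((x₀ :+ i :* i :* (A :* x :- B :* y)) :- x₀)
               := i :* i :* ((A :* A :+ B :* B) :* y)) refl A B x₀ y₀ t⁻¹ x y ⟩
        t⁻¹ * t⁻¹ * ((A * A + B * B) * y) ≡⟨ cancel-norm y ⟩
        y ∎)

    d²-similarity : ∀ u v → d² (similarity u) (similarity v) ≡ t * t * d² u v
    d²-similarity (x , y) (x′ , y′) = begin
      _ ≡⟨ solve 8 (λ A B x₀ y₀ x y x′ y′ →
             let X = (A :* (x :- x₀) :+ B :* (y :- y₀)) :- (A :* (x′ :- x₀) :+ B :* (y′ :- y₀))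
                 Y = (A :* (y :- y₀) :- B :* (x :- x₀)) :- (A :* (y′ :- y₀) :- B :* (x′ :- x₀)) in
             X :* X :+ Y :* Y
             := (A :* A :+ B :* B) :* ((x :- x′) :* (x :- x′) :+ (y :- y′) :* (y :- y′))) refl
             A B x₀ y₀ x y x′ y′ ⟩
      (A * A + B * B) * d² (x , y) (x′ , y′) ≡⟨ cong (_* d² (x , y) (x′ , y′)) norm ⟩
      t * t * d² (x , y) (x′ , y′) ∎

    similarity-isAutomorphism : IsAutomorphism similarity
    similarity-isAutomorphism = record
      { bijective =
          (λ {u} {v} eq → trans (sym (similarity-inverseˡ u)) (trans (cong similarity⁻¹ eq) (similarity-inverseˡ v)))
        , λ v → similarity⁻¹ v , λ { refl → similarity-inverseʳ v }
      ; preserves-Δ = λ u v → cong (λ b → if b then 1 else 0)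
          (does-⇔ (mk⇔ (contract u v) (expand u v)) (□? (d² (similarity u) (similarity v))) (□? (d² u v)))
      ; maps-lines = λ u w → similarity u , direction w
          , (λ { (_ , (s , refl) , refl) → s , along u w s })
          , (λ { (s , refl) → _ , (s , refl) , along u w s })
      }
      where
      expand : ∀ u v → d² u v ∈ □ → d² (similarity u) (similarity v) ∈ □
      expand u v (s , d²≡s²) = t * s , (begin
        d² (similarity u) (similarity v)   ≡⟨ d²-similarity u v ⟩
        t * t * d² u v                     ≡⟨ cong (t * t *_) d²≡s² ⟩
        t * t * (s * s)                    ≡⟨ solve 2 (λ t s → t :* t :* (s :* s) := t :* s :* (t :* s)) refl t s ⟩
        t * s * (t * s)                    ∎)
      contract : ∀ u v → d² (similarity u) (similarity v) ∈ □ → d² u v ∈ □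
      contract u v (s , eq) = t⁻¹ * s , (begin
        d² u v                                          ≡⟨ cancel-norm (d² u v) ⟨
        t⁻¹ * t⁻¹ * ((A * A + B * B) * d² u v)          ≡⟨ cong (λ N → t⁻¹ * t⁻¹ * (N * d² u v)) norm ⟩
        t⁻¹ * t⁻¹ * (t * t * d² u v)                    ≡⟨ cong (t⁻¹ * t⁻¹ *_) (d²-similarity u v) ⟨
        t⁻¹ * t⁻¹ * d² (similarity u) (similarity v)    ≡⟨ cong (t⁻¹ * t⁻¹ *_) eq ⟩
        t⁻¹ * t⁻¹ * (s * s)                             ≡⟨ solve 2 (λ t s → t :* t :* (s :* s) := t :* s :* (t :* s)) refl t⁻¹ s ⟩
        t⁻¹ * s * (t⁻¹ * s)                             ∎)
      direction : Point → Point
      direction (w₁ , w₂) = A * w₁ + B * w₂ , A * w₂ - B * w₁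
      along : ∀ ((u₁ , u₂) : Point) ((w₁ , w₂) : Point) s → similarity (u₁ + s * w₁ , u₂ + s * w₂) ≡
        ( proj₁ (similarity (u₁ , u₂)) + s * proj₁ (direction (w₁ , w₂))
        , proj₂ (similarity (u₁ , u₂)) + s * proj₂ (direction (w₁ , w₂)))
      along (u₁ , u₂) (w₁ , w₂) s = cong₂ _,_
        (solve 9 (λ A B x₀ y₀ u₁ u₂ w₁ w₂ s →
          A :* ((u₁ :+ s :* w₁) :- x₀) :+ B :* ((u₂ :+ s :* w₂) :- y₀)
          := (A :* (u₁ :- x₀) :+ B :* (u₂ :- y₀)) :+ s :* (A :* w₁ :+ B :* w₂)) refl A B x₀ y₀ u₁ u₂ w₁ w₂ s)
        (solve 9 (λ A B x₀ y₀ u₁ u₂ w₁ w₂ s →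
          A :* ((u₂ :+ s :* w₂) :- y₀) :- B :* ((u₁ :+ s :* w₁) :- x₀)
          := (A :* (u₂ :- y₀) :- B :* (u₁ :- x₀)) :+ s :* (A :* w₂ :- B :* w₁)) refl A B x₀ y₀ u₁ u₂ w₁ w₂ s)

-- Residues modulo a prime.

odd-prime : ∀ {p} → Prime p → 3 ≤ p → ∃ λ h → 1 ≤ h × p ≡ suc (h ℕ.+ h)
odd-prime {p} p-prime 3≤p with p % 2 | m%n<n p 2 | m≡m%n+[m/n]*n p 2
... | 0 | _ | p≡ with prime⇒irreducible p-prime (divides (p / 2) p≡)
...   | inj₂ 2≡p = ⊥-elim (ℕ.1+n≰n (subst (3 ≤_) (sym 2≡p) 3≤p))
odd-prime {p} p-prime 3≤p | 1 | _ | p≡ = p / 2 , 1≤h , p≡1+2h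
  where
  p≡1+2h : p ≡ suc (p / 2 ℕ.+ p / 2)
  p≡1+2h = trans p≡ (cong suc (trans (ℕ.*-comm (p / 2) 2) (cong (p / 2 ℕ.+_) (ℕ.+-identityʳ _))))
  1≤h : 1 ≤ p / 2
  1≤h = positive (p / 2) (subst (3 ≤_) p≡1+2h 3≤p)
    where
    positive : ∀ h → 3 ≤ suc (h ℕ.+ h) → 1 ≤ h
    positive zero    (s≤s ())
    positive (suc _) _ = s≤s z≤n
odd-prime {p} p-prime 3≤p | suc (suc _) | s≤s (s≤s ()) | _

module Divisibility (n : ℕ) .{{_ : NonZero n}} where

  open CommutativeRing (ℤ/ n) using (0#)
  open ModularArithmetic n

  mod≡0⇒∣ : ∀ {a} → a mod n ≡ 0# → n ∣ a
  mod≡0⇒∣ {a} eq = m%n≡0⇒n∣m a n (trans (sym (toℕ-mod a)) (trans (cong toℕ eq) (trans (toℕ-mod 0) (n∣m⇒m%n≡0 0 n (divides 0 refl)))))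

  ∣⇒mod≡0 : ∀ {a} → n ∣ a → a mod n ≡ 0#
  ∣⇒mod≡0 {a} n∣a = mod-cong (trans (n∣m⇒m%n≡0 a n n∣a) (sym (n∣m⇒m%n≡0 0 n (divides 0 refl))))

module PrimeModulus (p : ℕ) .{{_ : NonZero p}} (p-prime : Prime p) where

  open CommutativeRing (ℤ/ p) using (_+_; _*_; 0#; 1#; isCommutativeRing)
  open ModularArithmetic p
  open FiniteDifferences isCommutativeRing using (ι)
  open Divisibility p public

  domain : ∀ x y → x * y ≡ 0# → x ≡ 0# ⊎ y ≡ 0#
  domain x y xy≡0 = Sum.map zero-if zero-if (euclidsLemma (toℕ x) (toℕ y) p-prime (mod≡0⇒∣ xy≡0))
    where
    zero-if : ∀ {x} → p ∣ toℕ x → x ≡ 0#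
    zero-if {x} p∣x = trans (sym (mod-toℕ x)) (∣⇒mod≡0 p∣x)

  ι≡mod : ∀ n → ι n ≡ n mod p
  ι≡mod zero    = refl
  ι≡mod (suc n) = trans (cong ((1 mod p) ⊕_) (ι≡mod n)) (mod-⊕ 1 n)

  2≢0 : 3 ≤ p → 1# + 1# ≢ 0#
  2≢0 3≤p eq = >⇒∤ 3≤p (mod≡0⇒∣ (trans (sym (mod-⊕ 1 1)) eq))

-- A theorem of Carlitz type, after Lovász and Schrijver.
injective⇒affine : ∀ p .{{_ : NonZero p}} → Prime p → 3 ≤ p →
  let open CommutativeRing (ℤ/ p) in
  (g : Carrier → Carrier) →
  (∀ c v → c * c + 1# ≡ v * v → Injective _≡_ _≡_ (λ x → g x + x * c)) →
  ∃₂ λ a b → ∀ x → g x ≡ a + b * x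
injective⇒affine p p-prime 3≤p g injective with odd-prime p-prime 3≤p
... | h , 1≤h , refl = moments⇒affine (injective⇒moments g injective)
  where
  open PrimeModulus p p-prime
  open ModularArithmetic p
  open OddPrimeField h 1≤h (CommutativeRing.isCommutativeRing (ℤ/ p))
    (λ x → trans (ι≡mod (toℕ x)) (mod-toℕ x)) (trans (ι≡mod p) (∣⇒mod≡0 (divides 1 (sym (ℕ.+-identityʳ p))))) domain

-- The norm in question is that of (r , 1).
NonsquareNorm : ∀ p .{{_ : NonZero p}} → Fin p → Set
NonsquareNorm p r = r * r + 1# ∉ Plane.□ p
  where open CommutativeRing (ℤ/ p)

-- Otherwise the squares are closed under adding 1, so every element is a square. A choice of square
-- roots is injective, hence onto, so both 1 and -1 are chosen roots; both belong to the element 1,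
-- which gives 1 = -1.
nonsquare-exists : ∀ p .{{_ : NonZero p}} → Prime p → 3 ≤ p → ∃ (NonsquareNorm p)
nonsquare-exists p p-prime 3≤p = ¬∀⟶∃¬ p _ (λ r → □? (r * r + 1#)) λ all-squares →
    let
      √ : Carrier → Carrier
      √ x = proj₁ (squareᶠ all-squares x)
      √-injective : Injective _≡_ _≡_ √
      √-injective = λ {x} {y} eq → trans (proj₂ (squareᶠ all-squares x))
        (trans (cong₂ _*_ eq eq) (sym (proj₂ (squareᶠ all-squares y))))
      a , √a≡1  = injective⇒surjective √-injective 1#
      b , √b≡-1 = injective⇒surjective √-injective (- 1#)
      a≡1 = trans (proj₂ (squareᶠ all-squares a)) (cong₂ _*_ √a≡1 √a≡1)
      b≡1 = trans (proj₂ (squareᶠ all-squares b)) (cong₂ _*_ √b≡-1 √b≡-1)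
      a≡b = trans a≡1 (trans (solve 0 (:1 :* :1 := (:- :1) :* (:- :1)) refl) (sym b≡1))
      1≡-1 : 1# ≡ - 1#
      1≡-1 = trans (sym √a≡1) (trans (cong √ a≡b) √b≡-1)
    in 2≢0 3≤p (trans (cong (1# +_) 1≡-1) (-‿inverseʳ 1#))
  where
  open Plane p
  open CommutativeRing (ℤ/ p) using (Carrier; isCommutativeRing)
  open FiniteDifferences isCommutativeRing
  open PrimeModulus p p-prime
  open ModularArithmetic p using (mod-toℕ)
  squares : (∀ r → r * r + 1# ∈ □) → ∀ n → ι n ∈ □
  squares all-squares zero = 0# , sym (zeroˡ 0#)
  squares all-squares (suc n) with squares all-squares n
  ... | r , ιn≡r² = subst (_∈ □) (trans (+-comm _ 1#) (cong (1# +_) (sym ιn≡r²))) (all-squares r)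
  squareᶠ : (∀ r → r * r + 1# ∈ □) → ∀ x → x ∈ □
  squareᶠ all-squares x = subst (_∈ □) (trans (ι≡mod (toℕ x)) (mod-toℕ x)) (squares all-squares (toℕ x))

open import Data.Nat using (_^_)

-- The sizes `p ^ 2` and `p ℕ.* p`, or `p ^ 3` and its product form, agree only propositionally.
injective⇒surjective-≡ : ∀ {m n} → m ≡ n → {f : Fin m → Fin n} → Injective _≡_ _≡_ f → ∀ y → ∃ λ x → f x ≡ y
injective⇒surjective-≡ refl = injective⇒surjective

-- Arithmetic modulo p²: reduction, digits and units.

module PrimeSquareModulus (p : ℕ) .{{_ : NonZero p}} (p-prime : Prime p) (3≤p : 3 ≤ p)
  (r : Fin p) (ν-nonsquare : NonsquareNorm p r) where

  open PrimeSquare p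
  open PrimeModulus p p-prime
  open FiniteDomain F.isCommutativeRing domain
  private
    module Mᶠ = ModularArithmetic p
    module Mᴿ = ModularArithmetic (p ^ 2)
    module Dᴿ = Divisibility (p ^ 2)
    module Fˢ = IntegerSolver (ℤ/ p)
    module Rˢ = IntegerSolver (ℤ/ (p ^ 2))
  open ≡-Reasoning

  p²≡p*p : p ^ 2 ≡ p ℕ.* p
  p²≡p*p = cong (p ℕ.*_) (ℕ.*-identityʳ p)

  reduce-mod : ∀ a → reduce (a mod (p ^ 2)) ≡ a mod p
  reduce-mod a = Mᶠ.mod-cong (trans (cong (_% p) (Mᴿ.toℕ-mod a)) (m∣n⇒o%n%m≡o%m p (p ^ 2) a (divides p p²≡p*p)))

  reduce-+ : ∀ x y → reduce (x R.+ y) ≡ reduce x F.+ reduce y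
  reduce-+ x y = trans (reduce-mod (toℕ x ℕ.+ toℕ y)) (sym (Mᶠ.mod-⊕ (toℕ x) (toℕ y)))

  reduce-* : ∀ x y → reduce (x R.* y) ≡ reduce x F.* reduce y
  reduce-* x y = trans (reduce-mod (toℕ x ℕ.* toℕ y)) (sym (Mᶠ.mod-⊗ (toℕ x) (toℕ y)))

  reduce-‿- : ∀ x y → reduce (x R.- y) ≡ reduce x F.- reduce y
  reduce-‿- x y = begin
    reduce (x R.- y)
      ≡⟨ Fˢ.solve 2 (λ a b → let open Fˢ in a := (a :+ b) :- b) refl _ (reduce y) ⟩
    (reduce (x R.- y) F.+ reduce y) F.- reduce y
      ≡⟨ cong (F._- reduce y) (reduce-+ (x R.- y) y) ⟨
    reduce ((x R.- y) R.+ y) F.- reduce y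
      ≡⟨ cong (λ z → reduce z F.- reduce y) (Rˢ.solve 2 (λ x y → let open Rˢ in (x :- y) :+ y := x) refl x y) ⟩
    reduce x F.- reduce y ∎

  reduce-pᴿ : reduce pᴿ ≡ F.0#
  reduce-pᴿ = trans (reduce-mod p) (∣⇒mod≡0 (divides 1 (sym (ℕ.*-identityˡ p))))

  reduce-*pᴿ : ∀ j → reduce (j R.* pᴿ) ≡ F.0#
  reduce-*pᴿ j = trans (reduce-* j pᴿ) (trans (cong (reduce j F.*_) reduce-pᴿ) (F.zeroʳ (reduce j)))

  pᴿ*pᴿ≡0 : pᴿ R.* pᴿ ≡ R.0#
  pᴿ*pᴿ≡0 = trans (Mᴿ.mod-⊗ p p) (Dᴿ.∣⇒mod≡0 (divides 1 (trans (sym p²≡p*p) (sym (ℕ.*-identityˡ (p ^ 2))))))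

  *pᴿ : ∀ k → (k mod (p ^ 2)) R.* pᴿ ≡ (k ℕ.* p) mod (p ^ 2)
  *pᴿ k = Mᴿ.mod-⊗ k p

  reduce≡0⇒*pᴿ : ∀ {x} → reduce x ≡ F.0# → ∃ λ j → x ≡ j R.* pᴿ
  reduce≡0⇒*pᴿ {x} x̄≡0 with mod≡0⇒∣ {toℕ x} x̄≡0
  ... | divides k x≡kp = k mod (p ^ 2) , (begin
    x                            ≡⟨ Mᴿ.mod-toℕ x ⟨
    toℕ x mod (p ^ 2)            ≡⟨ cong (_mod (p ^ 2)) x≡kp ⟩
    (k ℕ.* p) mod (p ^ 2)        ≡⟨ *pᴿ k ⟨
    (k mod (p ^ 2)) R.* pᴿ       ∎)

  *pᴿ≡0⇒reduce≡0 : ∀ {x} → x R.* pᴿ ≡ R.0# → reduce x ≡ F.0#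
  *pᴿ≡0⇒reduce≡0 {x} xp≡0 = ∣⇒mod≡0 (*-cancelʳ-∣ p (subst (_∣ toℕ x ℕ.* p) p²≡p*p (Dᴿ.mod≡0⇒∣ (begin
    (toℕ x ℕ.* p) mod (p ^ 2)             ≡⟨ *pᴿ (toℕ x) ⟨
    (toℕ x mod (p ^ 2)) R.* pᴿ            ≡⟨ cong (R._* pᴿ) (Mᴿ.mod-toℕ x) ⟩
    x R.* pᴿ                              ≡⟨ xp≡0 ⟩
    R.0#                                  ∎))))

  -- As p is prime it divides the root t as well, so t² is a multiple of p².
  □-reduce≡0⇒≡0 : ∀ {x} → x ∈ R².□ → reduce x ≡ F.0# → x ≡ R.0#
  □-reduce≡0⇒≡0 {x} (t , x≡t²) x̄≡0 = begin
    x                              ≡⟨ x≡t² ⟩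
    t R.* t                        ≡⟨ cong₂ R._*_ t≡jp t≡jp ⟩
    j R.* pᴿ R.* (j R.* pᴿ)        ≡⟨ Rˢ.solve 2 (λ j p → let open Rˢ in j :* p :* (j :* p) := j :* j :* (p :* p)) refl j pᴿ ⟩
    j R.* j R.* (pᴿ R.* pᴿ)        ≡⟨ cong (j R.* j R.*_) pᴿ*pᴿ≡0 ⟩
    j R.* j R.* R.0#               ≡⟨ R.zeroʳ (j R.* j) ⟩
    R.0#                           ∎
    where
    t̄≡0 : reduce t ≡ F.0#
    t̄≡0 = Sum.reduce (domain (reduce t) (reduce t) (trans (sym (reduce-* t t)) (trans (cong reduce (sym x≡t²)) x̄≡0)))
    j = proj₁ (reduce≡0⇒*pᴿ t̄≡0)
    t≡jp = proj₂ (reduce≡0⇒*pᴿ t̄≡0)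

  -- The upper digit in base p; `reduce` is the lower one.
  high : R.Carrier → Fin p
  high x = fromℕ< (m<n*o⇒m/o<n {toℕ x} {p} {p} (subst (toℕ x <_) p²≡p*p (toℕ<n x)))

  digits-injective : ∀ {x y} → reduce x ≡ reduce y → high x ≡ high y → x ≡ y
  digits-injective {x} {y} low≡ high≡ = toℕ-injective (begin
    toℕ x                              ≡⟨ m≡m%n+[m/n]*n (toℕ x) p ⟩
    toℕ x % p ℕ.+ toℕ x / p ℕ.* p      ≡⟨ cong₂ (λ a b → a ℕ.+ b ℕ.* p) low≡′ high≡′ ⟩
    toℕ y % p ℕ.+ toℕ y / p ℕ.* p      ≡⟨ m≡m%n+[m/n]*n (toℕ y) p ⟨
    toℕ y                              ∎)
    where
    low≡′ : toℕ x % p ≡ toℕ y % p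
    low≡′ = trans (sym (Mᶠ.toℕ-mod (toℕ x))) (trans (cong toℕ low≡) (Mᶠ.toℕ-mod (toℕ y)))
    high≡′ : toℕ x / p ≡ toℕ y / p
    high≡′ = trans (sym (toℕ-fromℕ< _)) (trans (cong toℕ high≡) (toℕ-fromℕ< _))

  digits-surjective : ∀ a b → ∃ λ x → reduce x ≡ a × high x ≡ b
  digits-surjective a b with injective⇒surjective-≡ p²≡p*p {λ x → combine (reduce x) (high x)}
    (λ {x} {y} eq → let low≡ , high≡ = combine-injective (reduce x) (high x) (reduce y) (high y) eq in
      digits-injective low≡ high≡) (combine a b)
  ... | x , eq = x , combine-injective (reduce x) (high x) a b eq

  -- One Newton step: if x y = 1 + j p, then x y (1 - j p) = 1 - j² p² = 1.
  unit-lift : ∀ {x y} → reduce x F.* reduce y ≡ F.1# → ∃ λ z → x R.* z ≡ R.1#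
  unit-lift {x} {y} x̄ȳ≡1 = from-difference (reduce≡0⇒*pᴿ (trans (reduce-‿- (x R.* y) R.1#)
      (trans (cong₂ F._-_ (trans (reduce-* x y) x̄ȳ≡1) (reduce-mod 1)) (F.-‿inverseʳ F.1#))))
    where
    from-difference : (∃ λ j → x R.* y R.- R.1# ≡ j R.* pᴿ) → ∃ λ z → x R.* z ≡ R.1#
    from-difference (j , xy-1≡jp) = y R.* (R.1# R.- j R.* pᴿ) , (begin
      x R.* (y R.* (R.1# R.- j R.* pᴿ))
        ≡⟨ Rˢ.solve 3 (λ x y e → let open Rˢ in x :* (y :* (:1 :- e)) := (:1 :+ (x :* y :- :1)) :* (:1 :- e)) refl x y (j R.* pᴿ) ⟩
      (R.1# R.+ (x R.* y R.- R.1#)) R.* (R.1# R.- j R.* pᴿ)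
        ≡⟨ cong (λ e → (R.1# R.+ e) R.* (R.1# R.- j R.* pᴿ)) xy-1≡jp ⟩
      (R.1# R.+ j R.* pᴿ) R.* (R.1# R.- j R.* pᴿ)
        ≡⟨ Rˢ.solve 2 (λ j p → let open Rˢ in (:1 :+ j :* p) :* (:1 :- j :* p) := :1 :- j :* j :* (p :* p)) refl j pᴿ ⟩
      R.1# R.- j R.* j R.* (pᴿ R.* pᴿ)
        ≡⟨ cong (λ z → R.1# R.- j R.* j R.* z) pᴿ*pᴿ≡0 ⟩
      R.1# R.- j R.* j R.* R.0#
        ≡⟨ Rˢ.solve 1 (λ j → let open Rˢ in :1 :- j :* j :* con (0 , 0) := :1) refl j ⟩
      R.1# ∎)

  unit : ∀ {x} → reduce x ≢ F.0# → ∃ λ z → x R.* z ≡ R.1#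
  unit {x} x̄≢0 = from-inverse (inverse x̄≢0)
    where
    from-lift : ∀ {i} → reduce x F.* i ≡ F.1# → (∃ λ y → reduce y ≡ i × high y ≡ F.0#) → ∃ λ z → x R.* z ≡ R.1#
    from-lift x̄i≡1 (y , refl , _) = unit-lift {x} {y} x̄i≡1
    from-inverse : (∃ λ i → reduce x F.* i ≡ F.1#) → ∃ λ z → x R.* z ≡ R.1#
    from-inverse (i , x̄i≡1) = from-lift x̄i≡1 (digits-surjective i F.0#)

  □-quotient : ∀ {a b} c → b ≢ F.0# → a F.* (b F.* b) ≡ c F.* c → a ∈ F².□
  □-quotient {a} {b} c b≢0 eq = from-inverse (inverse b≢0)
    where
    from-inverse : (∃ λ i → b F.* i ≡ F.1#) → a ∈ F².□
    from-inverse (i , bi≡1) = c F.* i , (begin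
      a                                  ≡⟨ Fˢ.solve 1 (λ a → let open Fˢ in a := a :* (:1 :* :1)) refl a ⟩
      a F.* (F.1# F.* F.1#)              ≡⟨ cong (λ u → a F.* (u F.* u)) bi≡1 ⟨
      a F.* (b F.* i F.* (b F.* i))      ≡⟨ Fˢ.solve 3 (λ a b i → let open Fˢ in a :* (b :* i :* (b :* i)) := a :* (b :* b) :* (i :* i)) refl a b i ⟩
      a F.* (b F.* b) F.* (i F.* i)      ≡⟨ cong (F._* (i F.* i)) eq ⟩
      c F.* c F.* (i F.* i)              ≡⟨ Fˢ.solve 2 (λ c i → let open Fˢ in c :* c :* (i :* i) := c :* i :* (c :* i)) refl c i ⟩
      c F.* i F.* (c F.* i)              ∎)

  -- The reduced plane and directions of nonsquare norm.

  reduce² : R².Point → F².Point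
  reduce² (x , y) = reduce x , reduce y

  reduce-d² : ∀ u v → reduce (R².d² u v) ≡ F².d² (reduce² u) (reduce² v)
  reduce-d² (x , y) (x′ , y′) = trans (reduce-+ _ _) (cong₂ F._+_ (square x x′) (square y y′))
    where
    square : ∀ x y → reduce ((x R.- y) R.* (x R.- y)) ≡ (reduce x F.- reduce y) F.* (reduce x F.- reduce y)
    square x y = trans (reduce-* (x R.- y) (x R.- y)) (cong₂ F._*_ (reduce-‿- x y) (reduce-‿- x y))

  ν : F.Carrier
  ν = r F.* r F.+ F.1#

  ν≢0 : ν ≢ F.0#
  ν≢0 ν≡0 = ν-nonsquare (F.0# , trans ν≡0 (sym (F.zeroˡ F.0#)))

  -- Its kernel is spanned by (r , 1), whose norm ν is not a square.
  transversal : F².Point → F.Carrier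
  transversal (x , y) = x F.- r F.* y

  -- The difference of the points is b (r , 1) with b = y - y′, so d² = ν b². If b ≠ 0, dividing by
  -- b² would make ν a square.
  transversal-separates : ∀ u v → F².d² u v ∈ F².□ → transversal u ≡ transversal v → u ≡ v
  transversal-separates (x , y) (x′ , y′) (s , d²≡s²) eq = cases (y F.- y′ ≟ F.0#)
    where
    x-x′ : x F.- x′ ≡ r F.* (y F.- y′)
    x-x′ = begin
      x F.- x′
        ≡⟨ Fˢ.solve 5 (λ r x y x′ y′ → let open Fˢ in
             x :- x′ := ((x :- r :* y) :- (x′ :- r :* y′)) :+ r :* (y :- y′)) refl r x y x′ y′ ⟩
      (transversal (x , y) F.- transversal (x′ , y′)) F.+ r F.* (y F.- y′)
        ≡⟨ cong (λ a → (a F.- transversal (x′ , y′)) F.+ r F.* (y F.- y′)) eq ⟩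
      (transversal (x′ , y′) F.- transversal (x′ , y′)) F.+ r F.* (y F.- y′)
        ≡⟨ Fˢ.solve 2 (λ a b → let open Fˢ in (a :- a) :+ b := b) refl (transversal (x′ , y′)) _ ⟩
      r F.* (y F.- y′) ∎
    same-ordinate : y ≡ y′ → (x , y) ≡ (x′ , y′)
    same-ordinate refl = cong (_, y) (begin
      x                            ≡⟨ Fˢ.solve 2 (λ x a → let open Fˢ in x := (x :- a) :+ a) refl x (r F.* y) ⟩
      transversal (x , y) F.+ r F.* y    ≡⟨ cong (F._+ r F.* y) eq ⟩
      transversal (x′ , y) F.+ r F.* y   ≡⟨ Fˢ.solve 2 (λ x a → let open Fˢ in (x :- a) :+ a := x) refl x′ (r F.* y) ⟩
      x′                           ∎)
    cases : Dec (y F.- y′ ≡ F.0#) → (x , y) ≡ (x′ , y′)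
    cases (yes δ≡0) = same-ordinate (difference-zero δ≡0)
    cases (no δ≢0) = ⊥-elim (ν-nonsquare (□-quotient s δ≢0 (begin
      ν F.* ((y F.- y′) F.* (y F.- y′))
        ≡⟨ Fˢ.solve 2 (λ r d → let open Fˢ in (r :* r :+ :1) :* (d :* d) := (r :* d) :* (r :* d) :+ d :* d) refl r (y F.- y′) ⟩
      r F.* (y F.- y′) F.* (r F.* (y F.- y′)) F.+ (y F.- y′) F.* (y F.- y′)
        ≡⟨ cong (λ a → a F.* a F.+ (y F.- y′) F.* (y F.- y′)) x-x′ ⟨
      F².d² (x , y) (x′ , y′)
        ≡⟨ d²≡s² ⟩
      s F.* s ∎)))

  -- Subtracting the two equations leaves 2 A p = p² = 0, so p divides 2 A, and p is odd. In use, A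
  -- is the difference in one coordinate and C the squared difference in the other.
  null-shift : ∀ A C → A R.* A R.+ C ≡ R.0# → (A R.- pᴿ) R.* (A R.- pᴿ) R.+ C ≡ R.0# → reduce A ≡ F.0#
  null-shift A C null null′ =
    Sum.[ (λ 2≡0 → ⊥-elim (2≢0 3≤p 2≡0)) , (λ Ā≡0 → Ā≡0) ]′ (domain (F.1# F.+ F.1#) (reduce A) (begin
      (F.1# F.+ F.1#) F.* reduce A
        ≡⟨ Fˢ.solve 1 (λ a → let open Fˢ in :2 :* a := a :+ a) refl (reduce A) ⟩
      reduce A F.+ reduce A
        ≡⟨ reduce-+ A A ⟨
      reduce (A R.+ A)
        ≡⟨ *pᴿ≡0⇒reduce≡0 (begin
          (A R.+ A) R.* pᴿ
            ≡⟨ Rˢ.solve 3 (λ A C p → let open Rˢ in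
                 (A :+ A) :* p := ((A :* A :+ C) :- ((A :- p) :* (A :- p) :+ C)) :+ p :* p) refl A C pᴿ ⟩
          ((A R.* A R.+ C) R.- ((A R.- pᴿ) R.* (A R.- pᴿ) R.+ C)) R.+ pᴿ R.* pᴿ
            ≡⟨ cong₂ R._+_ (cong₂ R._-_ null null′) pᴿ*pᴿ≡0 ⟩
          (R.0# R.- R.0#) R.+ R.0#
            ≡⟨ Rˢ.solve 0 (let open Rˢ in (con (0 , 0) :- con (0 , 0)) :+ con (0 , 0) := con (0 , 0)) refl ⟩
          R.0# ∎) ⟩
      F.0# ∎))

  -- ν d² = (y + r x)² + (x − r y)² for a difference (x , y), so a direction with
  -- y + r x = − c (x − r y) has norm ν times a square whenever c² + 1 is a square.
  directions-avoided : ∀ u v c w → c F.* c F.+ F.1# ≡ w F.* w →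
    F².d² u v ∈ F².□ → (F².d² u v ≡ F.0# → u ≡ v) →
    let twist = λ ((x , y) : F².Point) → (y F.+ r F.* x) F.+ transversal (x , y) F.* c in
    twist u ≡ twist v → u ≡ v
  directions-avoided u@(x , y) v@(x′ , y′) c w c²+1≡w² (s , d²≡s²) anisotropic eq = cases (s ≟ F.0#)
    where
    a = x F.- x′
    b = y F.- y′
    δ = a F.- r F.* b
    twist : F².Point → F.Carrier
    twist (x , y) = (y F.+ r F.* x) F.+ transversal (x , y) F.* c
    twisted : b F.+ r F.* a ≡ F.- (c F.* δ)
    twisted = begin
      b F.+ r F.* a
        ≡⟨ Fˢ.solve 6 (λ r c x y x′ y′ → let open Fˢ in
             (y :- y′) :+ r :* (x :- x′)
             := (((y :+ r :* x) :+ (x :- r :* y) :* c) :- ((y′ :+ r :* x′) :+ (x′ :- r :* y′) :* c))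
                :- c :* ((x :- x′) :- r :* (y :- y′))) refl r c x y x′ y′ ⟩
      (twist u F.- twist v) F.- c F.* δ
        ≡⟨ cong (λ t → (t F.- twist v) F.- c F.* δ) eq ⟩
      (twist v F.- twist v) F.- c F.* δ
        ≡⟨ Fˢ.solve 2 (λ t d → let open Fˢ in (t :- t) :- d := :- d) refl (twist v) (c F.* δ) ⟩
      F.- (c F.* δ) ∎
    cases : Dec (s ≡ F.0#) → u ≡ v
    cases (yes refl) = anisotropic (trans d²≡s² (F.zeroˡ F.0#))
    cases (no s≢0) = ⊥-elim (ν-nonsquare (□-quotient (w F.* δ) s≢0 (begin
      ν F.* (s F.* s)
        ≡⟨ cong (ν F.*_) d²≡s² ⟨
      ν F.* F².d² u v
        ≡⟨ Fˢ.solve 3 (λ r a b → let open Fˢ in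
             (r :* r :+ :1) :* (a :* a :+ b :* b)
             := (b :+ r :* a) :* (b :+ r :* a) :+ (a :- r :* b) :* (a :- r :* b)) refl r a b ⟩
      (b F.+ r F.* a) F.* (b F.+ r F.* a) F.+ δ F.* δ
        ≡⟨ cong (λ t → t F.* t F.+ δ F.* δ) twisted ⟩
      (F.- (c F.* δ)) F.* (F.- (c F.* δ)) F.+ δ F.* δ
        ≡⟨ Fˢ.solve 2 (λ c d → let open Fˢ in (:- (c :* d)) :* (:- (c :* d)) :+ d :* d := (c :* c :+ :1) :* (d :* d)) refl c δ ⟩
      (c F.* c F.+ F.1#) F.* (δ F.* δ)
        ≡⟨ cong (F._* (δ F.* δ)) c²+1≡w² ⟩
      w F.* w F.* (δ F.* δ)
        ≡⟨ Fˢ.solve 2 (λ w d → let open Fˢ in w :* w :* (d :* d) := w :* d :* (w :* d)) refl w δ ⟩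
      w F.* δ F.* (w F.* δ) ∎)))

  reduce-□ : ∀ {x} → x ∈ R².□ → reduce x ∈ F².□
  reduce-□ (t , x≡t²) = reduce t , trans (cong reduce x≡t²) (reduce-* t t)

  -- Integral sets and their reductions.

  module IntegralSet (S : R².PointSet) (integral : R².IsIntegral S) where

    d²∈□ : ∀ {u v} → u ∈ S → v ∈ S → F².d² (reduce² u) (reduce² v) ∈ F².□
    d²∈□ {u} {v} u∈S v∈S = subst (_∈ F².□) (reduce-d² u v) (reduce-□ (integral u v u∈S v∈S))

    same-transversal : ∀ {u v} → u ∈ S → v ∈ S →
      transversal (reduce² u) ≡ transversal (reduce² v) → reduce² u ≡ reduce² v
    same-transversal {u} {v} u∈S v∈S = transversal-separates (reduce² u) (reduce² v) (d²∈□ u∈S v∈S)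

  -- The situation that cardinality p³ forces: `S` is a union of full fibres of the reduction, one
  -- over each value of `transversal`.
  module SaturatedSet (S : R².PointSet) (integral : R².IsIntegral S)
    (saturated : ∀ {u v} → u ∈ S → reduce² u ≡ reduce² v → v ∈ S)
    (point : F.Carrier → R².Point) (point∈S : ∀ a → point a ∈ S)
    (transversal-point : ∀ a → transversal (reduce² (point a)) ≡ a) where

    open IntegralSet S integral

    d²≡0 : ∀ {u v} → u ∈ S → v ∈ S → F².d² (reduce² u) (reduce² v) ≡ F.0# → R².d² u v ≡ R.0#
    d²≡0 {u} {v} u∈S v∈S null = □-reduce≡0⇒≡0 (integral u v u∈S v∈S) (trans (reduce-d² u v) null)

    -- All lifts of v̄ belong to S, and not all of them can be at distance 0 from u.
    anisotropic : ∀ {u v} → u ∈ S → v ∈ S → F².d² (reduce² u) (reduce² v) ≡ F.0# → reduce² u ≡ reduce² v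
    anisotropic {u@(x , y)} {v@(x′ , y′)} u∈S v∈S null = cong₂ _,_
      (equal x x′ (null-shift (x R.- x′) (sq y y′) d²uv (begin
        (x R.- x′ R.- pᴿ) R.* (x R.- x′ R.- pᴿ) R.+ sq y y′
          ≡⟨ cong (λ a → a R.* a R.+ sq y y′) (shifted x x′) ⟩
        R².d² u (x′ R.+ pᴿ , y′)
          ≡⟨ null-lift (cong (_, reduce y′) (sym (reduce-shift x′))) ⟩
        R.0# ∎)))
      (equal y y′ (null-shift (y R.- y′) (sq x x′) (trans (R.+-comm (sq y y′) (sq x x′)) d²uv) (begin
        (y R.- y′ R.- pᴿ) R.* (y R.- y′ R.- pᴿ) R.+ sq x x′
          ≡⟨ cong (λ a → a R.* a R.+ sq x x′) (shifted y y′) ⟩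
        sq y (y′ R.+ pᴿ) R.+ sq x x′
          ≡⟨ R.+-comm (sq y (y′ R.+ pᴿ)) (sq x x′) ⟩
        R².d² u (x′ , y′ R.+ pᴿ)
          ≡⟨ null-lift (cong (reduce x′ ,_) (sym (reduce-shift y′))) ⟩
        R.0# ∎)))
      where
      sq : R.Carrier → R.Carrier → R.Carrier
      sq z z′ = (z R.- z′) R.* (z R.- z′)
      d²uv : R².d² u v ≡ R.0#
      d²uv = d²≡0 u∈S v∈S null
      reduce-shift : ∀ z → reduce (z R.+ pᴿ) ≡ reduce z
      reduce-shift z = trans (reduce-+ z pᴿ) (trans (cong (reduce z F.+_) reduce-pᴿ) (F.+-identityʳ _))
      shifted : ∀ z z′ → (z R.- z′) R.- pᴿ ≡ z R.- (z′ R.+ pᴿ)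
      shifted z z′ = Rˢ.solve 3 (λ z z′ p → let open Rˢ in (z :- z′) :- p := z :- (z′ :+ p)) refl z z′ pᴿ
      null-lift : ∀ {w} → reduce² v ≡ reduce² w → R².d² u w ≡ R.0#
      null-lift {w} v̄≡w̄ = d²≡0 u∈S (saturated v∈S v̄≡w̄) (trans (cong (F².d² (reduce² u)) (sym v̄≡w̄)) null)
      equal : ∀ z z′ → reduce (z R.- z′) ≡ F.0# → reduce z ≡ reduce z′
      equal z z′ eq = difference-zero (trans (sym (reduce-‿- z z′)) eq)

    f : F.Carrier → F.Carrier
    f a = reduce (proj₂ (point a))

    ∈S⇒graph : ∀ {v} → v ∈ S → reduce (proj₂ v) ≡ f (transversal (reduce² v))
    ∈S⇒graph {v} v∈S = proj₂ (,-injective (same-transversal v∈S (point∈S _) (sym (transversal-point _))))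

    graph⇒∈S : ∀ {v} → reduce (proj₂ v) ≡ f (transversal (reduce² v)) → v ∈ S
    graph⇒∈S {v@(x , y)} ȳ≡ = saturated (point∈S t) (cong₂ _,_ x̄≡ (sym ȳ≡))
      where
      t = transversal (reduce² v)
      x₁ = reduce (proj₁ (point t))
      x̄≡ : x₁ ≡ reduce x
      x̄≡ = begin
        x₁                                  ≡⟨ Fˢ.solve 2 (λ x a → let open Fˢ in x := (x :- a) :+ a) refl x₁ (r F.* f t) ⟩
        transversal (reduce² (point t)) F.+ r F.* f t   ≡⟨ cong₂ (λ a b → a F.+ r F.* b) (transversal-point t) (sym ȳ≡) ⟩
        t F.+ r F.* reduce y                ≡⟨ Fˢ.solve 2 (λ x a → let open Fˢ in (x :- a) :+ a := x) refl (reduce x) (r F.* reduce y) ⟩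
        reduce x                            ∎

    abscissa : ∀ a → reduce (proj₁ (point a)) ≡ a F.+ r F.* f a
    abscissa a = begin
      reduce (proj₁ (point a))
        ≡⟨ Fˢ.solve 2 (λ x a → let open Fˢ in x := (x :- a) :+ a) refl _ (r F.* f a) ⟩
      transversal (reduce² (point a)) F.+ r F.* f a
        ≡⟨ cong (F._+ r F.* f a) (transversal-point a) ⟩
      a F.+ r F.* f a ∎

    -- The pair a , g a consists of the coordinates x - r y and y + r x of the reduced point. In
    -- them the directions excluded by `directions-avoided` are the slopes -c with c² + 1 a square.
    g : F.Carrier → F.Carrier
    g a = f a F.+ r F.* reduce (proj₁ (point a))

    g-injective : ∀ c w → c F.* c F.+ F.1# ≡ w F.* w → Injective _≡_ _≡_ (λ a → g a F.+ a F.* c)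
    g-injective c w c²+1≡w² {a} {a′} eq = begin
      a                                     ≡⟨ transversal-point a ⟨
      transversal (reduce² (point a))       ≡⟨ cong transversal (directions-avoided _ _ c w c²+1≡w²
                                                 (d²∈□ (point∈S a) (point∈S a′)) (anisotropic (point∈S a) (point∈S a′))
                                                 (trans (cong (λ t → g a F.+ t F.* c) (transversal-point a))
                                                   (trans eq (cong (λ t → g a′ F.+ t F.* c) (sym (transversal-point a′)))))) ⟩
      transversal (reduce² (point a′))      ≡⟨ transversal-point a′ ⟩
      a′                                    ∎

    -- Since the abscissa is a + r f a, the definition of `g` reads g a = ν f a + r a, which can be
    -- solved for f a because ν ≠ 0.
    f-affine : ∃₂ λ n k → ∀ a → f a ≡ n F.+ k F.* a
    f-affine = solve-f (injective⇒affine p p-prime 3≤p g g-injective) (inverse ν≢0)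
      where
      solve-f : (∃₂ λ α β → ∀ a → g a ≡ α F.+ β F.* a) → (∃ λ ν⁻¹ → ν F.* ν⁻¹ ≡ F.1#) →
        ∃₂ λ n k → ∀ a → f a ≡ n F.+ k F.* a
      solve-f (α , β , g≡) (ν⁻¹ , νν⁻¹≡1) = ν⁻¹ F.* α , ν⁻¹ F.* (β F.- r) , λ a → *-cancelˡ-nonzero ν≢0 (begin
        ν F.* f a
          ≡⟨ Fˢ.solve 3 (λ r f a → let open Fˢ in (r :* r :+ :1) :* f := (f :+ r :* (a :+ r :* f)) :- r :* a) refl r (f a) a ⟩
        (f a F.+ r F.* (a F.+ r F.* f a)) F.- r F.* a
          ≡⟨ cong (λ x → (f a F.+ r F.* x) F.- r F.* a) (abscissa a) ⟨
        g a F.- r F.* a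
          ≡⟨ cong (F._- r F.* a) (g≡ a) ⟩
        (α F.+ β F.* a) F.- r F.* a
          ≡⟨ Fˢ.solve 4 (λ r α β a → let open Fˢ in (α :+ β :* a) :- r :* a := :1 :* (α :+ (β :- r) :* a)) refl r α β a ⟩
        F.1# F.* (α F.+ (β F.- r) F.* a)
          ≡⟨ cong (F._* (α F.+ (β F.- r) F.* a)) νν⁻¹≡1 ⟨
        ν F.* ν⁻¹ F.* (α F.+ (β F.- r) F.* a)
          ≡⟨ Fˢ.solve 5 (λ v i α b a → let open Fˢ in v :* i :* (α :+ b :* a) := v :* (i :* α :+ i :* b :* a)) refl ν ν⁻¹ α (β F.- r) a ⟩
        ν F.* (ν⁻¹ F.* α F.+ ν⁻¹ F.* (β F.- r) F.* a) ∎)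

    -- Otherwise the two reduced points are at distance 0 and coincide by `anisotropic`, although
    -- their transversal coordinates are 1 and 0.
    t̄≢0 : ∀ {t} → R².d² (point F.1#) (point F.0#) ≡ t R.* t → reduce t ≢ F.0#
    t̄≢0 {t} d²≡t² t̄≡0 = 2≢0 3≤p (trans (cong₂ F._+_ 1≡0 1≡0) (F.+-identityˡ F.0#))
      where
      1≡0 : F.1# ≡ F.0#
      1≡0 = begin
        F.1#                                ≡⟨ transversal-point F.1# ⟨
        transversal (reduce² (point F.1#))  ≡⟨ cong transversal (anisotropic (point∈S F.1#) (point∈S F.0#) (begin
          F².d² (reduce² (point F.1#)) (reduce² (point F.0#))   ≡⟨ reduce-d² (point F.1#) (point F.0#) ⟨
          reduce (R².d² (point F.1#) (point F.0#))              ≡⟨ cong reduce d²≡t² ⟩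
          reduce (t R.* t)                                      ≡⟨ reduce-* t t ⟩
          reduce t F.* reduce t                                 ≡⟨ cong (F._* reduce t) t̄≡0 ⟩
          F.0# F.* reduce t                                     ≡⟨ F.zeroˡ (reduce t) ⟩
          F.0#                                                  ∎)) ⟩
        transversal (reduce² (point F.0#))  ≡⟨ transversal-point F.0# ⟩
        F.0#                                ∎

    -- The similarity is centred at `point F.0#` and lays the direction towards `point F.1#` along
    -- the first axis. Modulo p this direction is (1 + r k , k), on which `transversal` is 1, so the
    -- second coordinate of an image is exactly y - f (x - r y) modulo p. It vanishes precisely on
    -- `S`, and `setA` is where the second coordinate vanishes modulo p.
    line⇒isomorphic-setA : ∀ n k → (∀ a → f a ≡ n F.+ k F.* a) →
      ∀ t → R².d² (point F.1#) (point F.0#) ≡ t R.* t → ∀ t⁻¹ → t R.* t⁻¹ ≡ R.1# → R².Isomorphic S setA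
    line⇒isomorphic-setA n k f≡ t d²≡t² t⁻¹ tt⁻¹≡1 =
      φ , similarity-isAutomorphism , (λ { (v , v∈S , refl) → image∈A v∈S }) , λ {w} → A∈image w
      where
      x₀ = proj₁ (point F.0#)
      y₀ = proj₂ (point F.0#)
      x₁ = proj₁ (point F.1#)
      y₁ = proj₂ (point F.1#)
      A = x₁ R.- x₀
      B = y₁ R.- y₀
      open Similarity (p ^ 2)
      open UnitNorm A B x₀ y₀ t t⁻¹ d²≡t² tt⁻¹≡1
      φ : R².Point → R².Point
      φ = similarity
      second : ∀ v → reduce (proj₂ (φ v)) ≡ reduce (proj₂ v) F.- f (transversal (reduce² v))
      second v@(x , y) = begin
        reduce (A R.* (y R.- y₀) R.- B R.* (x R.- x₀))
          ≡⟨ reduce-‿- _ _ ⟩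
        reduce (A R.* (y R.- y₀)) F.- reduce (B R.* (x R.- x₀))
          ≡⟨ cong₂ F._-_ (expand x₁ x₀ y y₀) (expand y₁ y₀ x x₀) ⟩
        (reduce x₁ F.- reduce x₀) F.* (reduce y F.- f F.0#) F.- (f F.1# F.- f F.0#) F.* (reduce x F.- reduce x₀)
          ≡⟨ cong₂ (λ a b → (a F.- b) F.* (reduce y F.- f F.0#) F.- (f F.1# F.- f F.0#) F.* (reduce x F.- b))
               (abscissa F.1#) (abscissa F.0#) ⟩
        _ ≡⟨ cong₂ (λ a b → ((F.1# F.+ r F.* b) F.- (F.0# F.+ r F.* a)) F.* (reduce y F.- a)
                             F.- (b F.- a) F.* (reduce x F.- (F.0# F.+ r F.* a))) (f≡ F.0#) (f≡ F.1#) ⟩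
        _ ≡⟨ Fˢ.solve 5 (λ r n k x y → let open Fˢ ; :0 = con (0 , 0) ; a = n :+ k :* :0 ; b = n :+ k :* :1 in
               ((:1 :+ r :* b) :- (:0 :+ r :* a)) :* (y :- a) :- (b :- a) :* (x :- (:0 :+ r :* a))
               := y :- (n :+ k :* (x :- r :* y))) refl r n k (reduce x) (reduce y) ⟩
        reduce y F.- (n F.+ k F.* transversal (reduce² v))
          ≡⟨ cong (λ z → reduce y F.- z) (f≡ _) ⟨
        reduce y F.- f (transversal (reduce² v)) ∎
        where
        expand : ∀ a b c d → reduce ((a R.- b) R.* (c R.- d)) ≡ (reduce a F.- reduce b) F.* (reduce c F.- reduce d)
        expand a b c d = trans (reduce-* _ _) (cong₂ F._*_ (reduce-‿- a b) (reduce-‿- c d))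
      image∈A : ∀ {v} → v ∈ S → φ v ∈ setA
      image∈A {v} v∈S = let j , eq = reduce≡0⇒*pᴿ (trans (second v)
                              (trans (cong (F._- f (transversal (reduce² v))) (∈S⇒graph v∈S)) (F.-‿inverseʳ _)))
                        in proj₁ (φ v) , j , cong (proj₁ (φ v) ,_) eq
      A∈image : ∀ w → w ∈ setA → w ∈ R².image φ S
      A∈image w (i , j , refl) = similarity⁻¹ w , graph⇒∈S (difference-zero (begin
          _                                            ≡⟨ second (similarity⁻¹ w) ⟨
          reduce (proj₂ (φ (similarity⁻¹ w)))          ≡⟨ cong (λ u → reduce (proj₂ u)) (similarity-inverseʳ w) ⟩
          reduce (j R.* pᴿ)                            ≡⟨ reduce-*pᴿ j ⟩
          F.0#                                         ∎)) , similarity-inverseʳ w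

    isomorphic-setA : R².Isomorphic S setA
    isomorphic-setA = assemble f-affine (integral _ _ (point∈S F.1#) (point∈S F.0#))
      where
      assemble : (∃₂ λ n k → ∀ a → f a ≡ n F.+ k F.* a) → R².d² (point F.1#) (point F.0#) ∈ R².□ → R².Isomorphic S setA
      assemble (n , k , f≡) (t , d²≡t²) = with-unit (unit {t} (t̄≢0 {t} d²≡t²))
        where
        with-unit : (∃ λ t⁻¹ → t R.* t⁻¹ ≡ R.1#) → R².Isomorphic S setA
        with-unit (t⁻¹ , tt⁻¹≡1) = line⇒isomorphic-setA n k f≡ t d²≡t² t⁻¹ tt⁻¹≡1

  -- Counting integral sets.

  code : R².Point → Fin (p ℕ.* (p ℕ.* p))
  code v@(x , y) = combine (transversal (reduce² v)) (combine (high x) (high y))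

  p³≡p*p*p : p ^ 3 ≡ p ℕ.* (p ℕ.* p)
  p³≡p*p*p = cong (p ℕ.*_) p²≡p*p

  module _ (S : R².PointSet) (integral : R².IsIntegral S) where

    open IntegralSet S integral

    -- On `S` the transversal coordinate alone fixes both lower digits, and the code supplies the
    -- two upper ones.
    code-injective : ∀ {u v} → u ∈ S → v ∈ S → code u ≡ code v → u ≡ v
    code-injective {u@(x , y)} {v@(x′ , y′)} u∈S v∈S eq =
      let t≡ , highs≡ = combine-injective _ (combine (high x) (high y)) _ (combine (high x′) (high y′)) eq
          high-x≡ , high-y≡ = combine-injective (high x) (high y) (high x′) (high y′) highs≡
          low-x≡ , low-y≡ = ,-injective (same-transversal u∈S v∈S t≡)
      in cong₂ _,_ (digits-injective low-x≡ high-x≡) (digits-injective low-y≡ high-y≡)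

    module _ {m} (e : Fin m → R².Point) (e-injective : Injective _≡_ _≡_ e)
             (S⇔e : ∀ x → x ∈ S ⇔ ∃ λ i → e i ≡ x) where

      e∈S : ∀ i → e i ∈ S
      e∈S i = Equivalence.from (S⇔e (e i)) (i , refl)

      code-e-injective : Injective _≡_ _≡_ (code ∘ e)
      code-e-injective {i} {j} eq = e-injective (code-injective (e∈S i) (e∈S j) eq)

      cardinality-bound : m ≤ p ^ 3
      cardinality-bound = subst (m ≤_) (sym p³≡p*p*p) (injective⇒≤ code-e-injective)

      module _ (m≡p³ : m ≡ p ^ 3) where

        code-surjective : ∀ a b c → ∃ λ v → v ∈ S × transversal (reduce² v) ≡ a × high (proj₁ v) ≡ b × high (proj₂ v) ≡ c
        code-surjective a b c = decode (injective⇒surjective-≡ (trans m≡p³ p³≡p*p*p) code-e-injective (combine a (combine b c)))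
          where
          decode : (∃ λ i → code (e i) ≡ combine a (combine b c)) →
            ∃ λ v → v ∈ S × transversal (reduce² v) ≡ a × high (proj₁ v) ≡ b × high (proj₂ v) ≡ c
          decode (i , eq) =
            let t≡ , highs≡ = combine-injective _ (combine (high (proj₁ (e i))) (high (proj₂ (e i)))) a (combine b c) eq
            in e i , e∈S i , t≡ , combine-injective (high (proj₁ (e i))) (high (proj₂ (e i))) b c highs≡

        -- The code being onto, `S` has an element `w` with the upper digits of `v` and the common
        -- transversal coordinate of `u` and `v`. On `S` that coordinate fixes the reduction, so `w`
        -- has the lower digits of `v` too and w = v.
        saturated : ∀ {u v} → u ∈ S → reduce² u ≡ reduce² v → v ∈ S
        saturated {u} {v@(x , y)} u∈S ū≡v̄ = same-digits (code-surjective (transversal (reduce² v)) (high x) (high y))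
          where
          same-digits : (∃ λ w → w ∈ S × transversal (reduce² w) ≡ transversal (reduce² v) ×
            high (proj₁ w) ≡ high x × high (proj₂ w) ≡ high y) → v ∈ S
          same-digits (w , w∈S , t≡ , high-x≡ , high-y≡) =
            let low-x≡ , low-y≡ = ,-injective (trans (same-transversal w∈S u∈S (trans t≡ (cong transversal (sym ū≡v̄)))) ū≡v̄)
            in subst (_∈ S) (cong₂ _,_ (digits-injective low-x≡ high-x≡) (digits-injective low-y≡ high-y≡)) w∈S

        isomorphic-setA : R².Isomorphic S setA
        isomorphic-setA = SaturatedSet.isomorphic-setA S integral saturated point point∈S transversal-point
          where
          -- The upper digits 0 are an arbitrary choice among the lifts, all of which lie in `S`.
          point : F.Carrier → R².Point
          point a = proj₁ (code-surjective a F.0# F.0#)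
          point∈S : ∀ a → point a ∈ S
          point∈S a = proj₁ (proj₂ (code-surjective a F.0# F.0#))
          transversal-point : ∀ a → transversal (reduce² (point a)) ≡ a
          transversal-point a = proj₁ (proj₂ (proj₂ (code-surjective a F.0# F.0#)))

  -- The extremal set of case (a).

  setA-integral : R².IsIntegral setA
  setA-integral _ _ (i , j , refl) (i′ , j′ , refl) = i R.- i′ , (begin
    (i R.- i′) R.* (i R.- i′) R.+ (j R.* pᴿ R.- j′ R.* pᴿ) R.* (j R.* pᴿ R.- j′ R.* pᴿ)
      ≡⟨ Rˢ.solve 4 (λ a j j′ p → let open Rˢ in
           a :* a :+ (j :* p :- j′ :* p) :* (j :* p :- j′ :* p) := a :* a :+ (j :- j′) :* (j :- j′) :* (p :* p)) refl (i R.- i′) j j′ pᴿ ⟩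
    (i R.- i′) R.* (i R.- i′) R.+ (j R.- j′) R.* (j R.- j′) R.* (pᴿ R.* pᴿ)
      ≡⟨ cong (λ z → (i R.- i′) R.* (i R.- i′) R.+ (j R.- j′) R.* (j R.- j′) R.* z) pᴿ*pᴿ≡0 ⟩
    (i R.- i′) R.* (i R.- i′) R.+ (j R.- j′) R.* (j R.- j′) R.* R.0#
      ≡⟨ Rˢ.solve 2 (λ a b → let open Rˢ in a :* a :+ b :* b :* con (0 , 0) := a :* a) refl (i R.- i′) (j R.- j′) ⟩
    (i R.- i′) R.* (i R.- i′) ∎)

  *pᴿ-cong : ∀ {j k} → reduce j ≡ reduce k → j R.* pᴿ ≡ k R.* pᴿ
  *pᴿ-cong {j} {k} eq = from-difference (reduce≡0⇒*pᴿ {j R.- k} (trans (reduce-‿- j k)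
      (trans (cong (F._- reduce k) eq) (F.-‿inverseʳ (reduce k)))))
    where
    from-difference : (∃ λ l → j R.- k ≡ l R.* pᴿ) → j R.* pᴿ ≡ k R.* pᴿ
    from-difference (l , j-k≡lp) = begin
      j R.* pᴿ                           ≡⟨ Rˢ.solve 3 (λ j k p → let open Rˢ in j :* p := (j :- k) :* p :+ k :* p) refl j k pᴿ ⟩
      (j R.- k) R.* pᴿ R.+ k R.* pᴿ      ≡⟨ cong (λ z → z R.* pᴿ R.+ k R.* pᴿ) j-k≡lp ⟩
      l R.* pᴿ R.* pᴿ R.+ k R.* pᴿ       ≡⟨ cong (R._+ k R.* pᴿ) (R.*-assoc l pᴿ pᴿ) ⟩
      l R.* (pᴿ R.* pᴿ) R.+ k R.* pᴿ     ≡⟨ cong (λ z → l R.* z R.+ k R.* pᴿ) pᴿ*pᴿ≡0 ⟩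
      l R.* R.0# R.+ k R.* pᴿ            ≡⟨ Rˢ.solve 2 (λ l a → let open Rˢ in l :* con (0 , 0) :+ a := a) refl l _ ⟩
      k R.* pᴿ                           ∎

  *pᴿ-injective : ∀ {j k} → j R.* pᴿ ≡ k R.* pᴿ → reduce j ≡ reduce k
  *pᴿ-injective {j} {k} eq = difference-zero (trans (sym (reduce-‿- j k)) (*pᴿ≡0⇒reduce≡0 (begin
    (j R.- k) R.* pᴿ             ≡⟨ Rˢ.solve 3 (λ j k p → let open Rˢ in (j :- k) :* p := j :* p :- k :* p) refl j k pᴿ ⟩
    j R.* pᴿ R.- k R.* pᴿ        ≡⟨ cong (R._- k R.* pᴿ) eq ⟩
    k R.* pᴿ R.- k R.* pᴿ        ≡⟨ R.-‿inverseʳ _ ⟩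
    R.0#                         ∎)))

  -- The product j p depends on j only modulo p. Taking for each residue its lift with upper digit 0
  -- lists every second coordinate once, which gives p · p² points.
  setA-cardinality : R².HasCardinality setA (p ^ 3)
  setA-cardinality = enumerate , enumerate-injective , λ x → mk⇔ to (from x)
    where
    lift : F.Carrier → R.Carrier
    lift a = proj₁ (digits-surjective a F.0#)
    reduce-lift : ∀ a → reduce (lift a) ≡ a
    reduce-lift a = proj₁ (proj₂ (digits-surjective a F.0#))
    enumerate : Fin (p ^ 3) → R².Point
    enumerate k = let a , i = remQuot {p} (p ^ 2) k in i , lift a R.* pᴿ
    enumerate-injective : Injective _≡_ _≡_ enumerate
    enumerate-injective {k} {l} eq =
      let i≡ , a≡ = ,-injective eq in
      trans (sym (combine-remQuot {p} (p ^ 2) k)) (trans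
        (cong₂ combine (trans (sym (reduce-lift _)) (trans (*pᴿ-injective a≡) (reduce-lift _))) i≡)
        (combine-remQuot {p} (p ^ 2) l))
    to : ∀ {x} → x ∈ setA → ∃ λ k → enumerate k ≡ x
    to (i , j , refl) = combine (reduce j) i ,
      trans (cong (λ (a , i) → i , lift a R.* pᴿ) (remQuot-combine {p} (reduce j) i))
        (cong (i ,_) (*pᴿ-cong (reduce-lift (reduce j))))
    from : ∀ x → (∃ λ k → enumerate k ≡ x) → x ∈ setA
    from x (k , refl) = proj₂ (remQuot {p} (p ^ 2) k) , lift (proj₁ (remQuot {p} (p ^ 2) k)) , refl

theorem8 : (p : ℕ) .{{_ : NonZero p}} → Prime p → 3 ≤ p →
    let open PrimeSquare p in
    R².IsMaxIntegralCardinality (p ^ 3)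
    × (∀ (S : R².PointSet) → R².IsIntegral S → R².HasCardinality S (p ^ 3) →
    R².Isomorphic S setA
    ⊎ (F.- F.1# ∈ F².□
    × ∃ λ ω → ω R.* ω ≡ R.- R.1# × R².Isomorphic S (setB ω))
    ⊎ (F.- F.1# ∈ F².□
    × ∃ λ ωₚ → ωₚ F.* ωₚ ≡ F.- F.1# × R².Isomorphic S (setC ωₚ)))
theorem8 p p-prime 3≤p = from-nonsquare (nonsquare-exists p p-prime 3≤p)
  where
  open PrimeSquare p
  Cases : R².PointSet → Set
  Cases S = R².Isomorphic S setA
    ⊎ (F.- F.1# ∈ F².□ × ∃ λ ω → ω R.* ω ≡ R.- R.1# × R².Isomorphic S (setB ω))
    ⊎ (F.- F.1# ∈ F².□ × ∃ λ ωₚ → ωₚ F.* ωₚ ≡ F.- F.1# × R².Isomorphic S (setC ωₚ))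
  from-nonsquare : ∃ (NonsquareNorm p) →
    R².IsMaxIntegralCardinality (p ^ 3)
    × (∀ (S : R².PointSet) → R².IsIntegral S → R².HasCardinality S (p ^ 3) → Cases S)
  from-nonsquare (r , ν-nonsquare) =
    ( (setA , setA-integral , setA-cardinality)
    , λ { S k integral (e , e-injective , S⇔e) → cardinality-bound S integral e e-injective S⇔e })
    , λ { S integral (e , e-injective , S⇔e) → inj₁ (isomorphic-setA S integral e e-injective S⇔e refl) }
    where
    open PrimeSquareModulus p p-prime 3≤p r ν-nonsquare
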